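{- Let $n\ge 4$ be an integer and let $G$ be a simple graph. Then $G$ is isomorphic to the open wheel $W_n'$ if and only if all of the following hold: $$[x]\,da(G;x,y) = 2y^{n-1} + (n-2)y^{n-2}+ y,$$ $$[x^{n}]\,da(G;x,y) = 3y^{n+1}+(n-2)y^{n+2},$$ $$[x^{n+1}]\,da(G;x,y) = y^{n+3}.$$
   Context: All graphs are finite, simple and have at least one vertex. For a graph $G$, $S\subseteq V(G)$ and $u\in V(G)$, let $\bar S=V(G)\setminus S$, let $\delta_S(u)=|\{v\in S:\{u,v\}\in E(G)\}|$, and let $G[S]$ be the subgraph induced by $S$. The defensive alliance polynomial of $G$ is $$da(G;x,y)=\sum_{S} x^{|S|}\,y^{f_y(S)},\qquad f_y(S)=\min_{u\in S}\bigl(\delta_S(u)-\delta_{\bar S}(u)+|V(G)|\bigr),$$ where the sum runs over all non-empty $S\subseteq V(G)$ such that $G[S]$ is connected (single-vertex graphs are connected). $[x^k]\,da(G;x,y)$ denotes the coefficient of $x^k$ in $da(G;x,y)$, which is a polynomial in $y$. The open wheel (fan) $W_n'$ is the graph join $P_n+K_1$, i.e. the path $P_n$ on $n$ vertices together with one extra vertex adjacent to all vertices of the path (so it has $n+1$ vertices). -}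

module Defs where

open import Algebra.Bundles.Raw using (RawMonoid)
open import Data.Fin.Base using (Fin; toℕ; splitAt; fromℕ<)
open import Data.Fin.Properties using (toℕ<n; toℕ-injective; toℕ-fromℕ<) renaming (_≟_ to _≟F_; all? to allFin?)
open import Data.Fin.Subset using (Subset; inside; outside; _∈_; _∩_; ∁; ∣_∣; Nonempty)
open import Data.Fin.Subset.Properties using (_∈?_; nonempty?; ∣p∣≤n)
open import Data.Integer.Base using (+_; _⊖_) renaming (_+_ to _+ℤ_; _-_ to _-ℤ_; -_ to neg_)
import Data.Integer.Properties as ℤ
open import Data.List.Base using (List; []; _∷_; _++_; map; filter; foldr; replicate; [_]; allFin)
open import Data.List.Extrema.Nat using (min)
open import Data.Nat.Base using (ℕ; zero; suc; _+_; _∸_; _≤_; _<_; +-0-rawMonoid)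
open import Data.Nat.Properties using (≤-trans; m≤n+m; m<1+n⇒m<n∨m≡n; 1+n≢n; _≟_; <⇒≤; ≤-refl)
open import Data.Product.Base using (_×_; _,_)
open import Data.Sum.Base using (_⊎_; inj₁; inj₂)
open import Data.Empty using (⊥)
open import Data.Unit.Base using (⊤; tt)
open import Data.Vec.Base using (tabulate) renaming ([] to []ᵥ; _∷_ to _∷ᵥ_)
open import Function.Bundles using (_↔_; _⇔_; Inverse)
open import Level using (Level; 0ℓ)
open import Relation.Binary.Construct.Closure.ReflexiveTransitive using (Star; ε; _◅_; _◅◅_)
open import Relation.Binary.Core using (Rel)
open import Relation.Binary.Definitions using (Decidable; Symmetric; Irreflexive)
open import Relation.Binary.PropositionalEquality
  using (_≡_; _≢_; refl; sym; trans; cong; subst; ≢-sym; module ≡-Reasoning)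
open import Relation.Nullary.Decidable using (Dec; yes; no; does; map′; _×-dec_; _⊎-dec_; _→-dec_; ¬?)

private
  variable
    m n : ℕ

-- Univariate polynomials with coefficients in an additive monoid, as
-- coefficient lists in increasing degree.  Trailing zeros are allowed,
-- so equality is coefficientwise.

module Polynomial {c ℓ : Level} (R : RawMonoid c ℓ) where

  private module R = RawMonoid R

  infixl 6 _⊕_
  infix  4 _≈_

  Poly : Set c
  Poly = List R.Carrier

  coeff : ℕ → Poly → R.Carrier
  coeff _       []      = R.ε
  coeff zero    (a ∷ p) = a
  coeff (suc k) (a ∷ p) = coeff k p

  _≈_ : Rel Poly ℓ
  p ≈ q = ∀ k → coeff k p R.≈ coeff k q

  _⊕_ : Poly → Poly → Poly
  []      ⊕ q       = q
  (a ∷ p) ⊕ []      = a ∷ p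
  (a ∷ p) ⊕ (b ∷ q) = (a R.∙ b) ∷ (p ⊕ q)

  monomial : R.Carrier → ℕ → Poly
  monomial a k = replicate k R.ε ++ [ a ]

  sum : List Poly → Poly
  sum = foldr _⊕_ []

  rawMonoid : RawMonoid c ℓ
  rawMonoid = record { Carrier = Poly ; _≈_ = _≈_ ; _∙_ = _⊕_ ; ε = [] }

-- ℕ[x,y] is taken as ℕ[y][x].

module Y = Polynomial +-0-rawMonoid
module X = Polynomial Y.rawMonoid

ℕ[y] : Set
ℕ[y] = Y.Poly

ℕ[x,y] : Set
ℕ[x,y] = X.Poly

open Y public using (_⊕_; _≈_)

infix 7 _·y^_

_·y^_ : ℕ → ℕ → ℕ[y]
_·y^_ = Y.monomial

[x^_]_ : ℕ → ℕ[x,y] → ℕ[y]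
[x^_]_ = X.coeff

infix 5 [x^_]_

record Graph (n : ℕ) : Set₁ where
  infix 4 _~_ _~?_
  field
    _~_    : Rel (Fin n) 0ℓ
    _~?_   : Decidable _~_
    ~-sym  : Symmetric _~_
    irrefl : Irreflexive _≡_ _~_

  neighbours : Fin n → Subset n
  neighbours u = tabulate (λ v → does (u ~? v))

infix 4 _≅_

record _≅_ (G : Graph m) (H : Graph n) : Set where
  private
    module G = Graph G
    module H = Graph H
  field
    bijection : Fin m ↔ Fin n
  open Inverse bijection public using (to; from)
  field
    adjacency : ∀ {u v} → u G.~ v ⇔ to u H.~ to v

complete : ∀ n → Graph n
complete n = record
  { _~_    = _≢_
  ; _~?_   = λ u v → ¬? (u ≟F v)
  ; ~-sym  = ≢-sym
  ; irrefl = λ u≡v u≢v → u≢v u≡v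
  }

path : ∀ n → Graph n
path n = record
  { _~_    = λ u v → suc (toℕ u) ≡ toℕ v ⊎ suc (toℕ v) ≡ toℕ u
  ; _~?_   = λ u v → (suc (toℕ u) ≟ toℕ v) ⊎-dec (suc (toℕ v) ≟ toℕ u)
  ; ~-sym  = λ { (inj₁ p) → inj₂ p ; (inj₂ p) → inj₁ p }
  ; irrefl = λ { refl (inj₁ p) → 1+n≢n p ; refl (inj₂ p) → 1+n≢n p }
  }

module _ (G : Graph m) (H : Graph n) where
  private
    module G = Graph G
    module H = Graph H

  JoinAdjacent : Rel (Fin m ⊎ Fin n) 0ℓ
  JoinAdjacent (inj₁ u) (inj₁ v) = u G.~ v
  JoinAdjacent (inj₁ _) (inj₂ _) = ⊤
  JoinAdjacent (inj₂ _) (inj₁ _) = ⊤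
  JoinAdjacent (inj₂ u) (inj₂ v) = u H.~ v

  joinAdjacent? : Decidable JoinAdjacent
  joinAdjacent? (inj₁ u) (inj₁ v) = u G.~? v
  joinAdjacent? (inj₁ _) (inj₂ _) = yes tt
  joinAdjacent? (inj₂ _) (inj₁ _) = yes tt
  joinAdjacent? (inj₂ u) (inj₂ v) = u H.~? v

  joinAdjacent-sym : Symmetric JoinAdjacent
  joinAdjacent-sym {inj₁ _} {inj₁ _} p = G.~-sym p
  joinAdjacent-sym {inj₁ _} {inj₂ _} _ = tt
  joinAdjacent-sym {inj₂ _} {inj₁ _} _ = tt
  joinAdjacent-sym {inj₂ _} {inj₂ _} p = H.~-sym p

  joinAdjacent-irrefl : ∀ s → JoinAdjacent s s → ⊥
  joinAdjacent-irrefl (inj₁ _) = G.irrefl refl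
  joinAdjacent-irrefl (inj₂ _) = H.irrefl refl

  join : Graph (m + n)
  join = record
    { _~_    = λ u v → JoinAdjacent (splitAt m u) (splitAt m v)
    ; _~?_   = λ u v → joinAdjacent? (splitAt m u) (splitAt m v)
    ; ~-sym  = λ {u} {v} → joinAdjacent-sym {splitAt m u} {splitAt m v}
    ; irrefl = λ { {u} refl → joinAdjacent-irrefl (splitAt m u) }
    }

openWheel : ∀ n → Graph (n + 1)
openWheel n = join (path n) (complete 1)

-- The reflexive-transitive closure of a decidable relation on Fin n is
-- decidable (Warshall's algorithm).

module Reachability {R : Rel (Fin n) 0ℓ} (R? : Decidable R) where

  -- Via k u v: there is a walk from u to v all of whose interior
  -- vertices w satisfy toℕ w < k.
  Via : ∀ k → k ≤ n → Rel (Fin n) 0ℓ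
  Via zero    _   u v = u ≡ v ⊎ R u v
  Via (suc k) k<n u v = Via k k≤n u v ⊎ (Via k k≤n u w × Via k k≤n w v)
    where
    w   = fromℕ< k<n
    k≤n = <⇒≤ k<n

  via? : ∀ k k≤n → Decidable (Via k k≤n)
  via? zero    _   u v = (u ≟F v) ⊎-dec R? u v
  via? (suc k) k<n u v = via? k _ u v ⊎-dec (via? k _ u _ ×-dec via? k _ _ v)

  sound : ∀ k k≤n {u v} → Via k k≤n u v → Star R u v
  sound zero    _   (inj₁ refl)    = ε
  sound zero    _   (inj₂ r)       = r ◅ ε
  sound (suc k) k<n (inj₁ p)       = sound k _ p
  sound (suc k) k<n (inj₂ (p , q)) = sound k _ p ◅◅ sound k _ q

  base : ∀ k k≤n {u v} → u ≡ v ⊎ R u v → Via k k≤n u v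
  base zero    _   p = p
  base (suc k) k<n p = inj₁ (base k _ p)

  via-trans : ∀ k k≤n {u w v} → toℕ w < k →
              Via k k≤n u w → Via k k≤n w v → Via k k≤n u v
  via-trans (suc k) k<n {u} {w} {v} w<1+k p q with m<1+n⇒m<n∨m≡n w<1+k
  via-trans (suc k) k<n {u} {w} {v} _ p q | inj₂ w≡k =
    inj₂ (into p , out q)
    where
    w≡ : w ≡ fromℕ< k<n
    w≡ = toℕ-injective (trans w≡k (sym (toℕ-fromℕ< k<n)))
    into : Via (suc k) k<n u w → Via k _ u (fromℕ< k<n)
    into (inj₁ r)       = subst (Via k _ u) w≡ r
    into (inj₂ (r , _)) = r
    out : Via (suc k) k<n w v → Via k _ (fromℕ< k<n) v
    out (inj₁ r)       = subst (λ z → Via k _ z v) w≡ r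
    out (inj₂ (_ , r)) = r
  via-trans (suc k) k<n _ (inj₁ p) (inj₁ q) | inj₁ w<k =
    inj₁ (via-trans k _ w<k p q)
  via-trans (suc k) k<n _ (inj₁ p) (inj₂ (q , r)) | inj₁ w<k =
    inj₂ (via-trans k _ w<k p q , r)
  via-trans (suc k) k<n _ (inj₂ (p , q)) (inj₁ r) | inj₁ w<k =
    inj₂ (p , via-trans k _ w<k q r)
  via-trans (suc k) k<n _ (inj₂ (p , _)) (inj₂ (_ , s)) | inj₁ w<k =
    inj₂ (p , s)

  complete-via : ∀ {u v} → Star R u v → Via n ≤-refl u v
  complete-via ε                  = base n _ (inj₁ refl)
  complete-via (_◅_ {j = w} r rs) =
    via-trans n _ (toℕ<n w) (base n _ (inj₂ r)) (complete-via rs)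

  star? : Decidable (Star R)
  star? u v = map′ (sound n _) complete-via (via? n ≤-refl u v)

subsets : ∀ n → List (Subset n)
subsets zero    = [ []ᵥ ]
subsets (suc n) = map (outside ∷ᵥ_) (subsets n) ++ map (inside ∷ᵥ_) (subsets n)

elements : Subset n → List (Fin n)
elements S = filter (_∈? S) (allFin _)

-- The value at [] is irrelevant: only non-empty lists are used below.
minimum : List ℕ → ℕ
minimum []       = 0
minimum (k ∷ ks) = min k ks

∸-exact : ∀ a {b k} → b ≤ k → + ((a + k) ∸ b) ≡ (+ a -ℤ + b) +ℤ + k
∸-exact a {b} {k} b≤k = begin
  + ((a + k) ∸ b)         ≡⟨ ℤ.⊖-≥ (≤-trans b≤k (m≤n+m k a)) ⟨
  (a + k) ⊖ b             ≡⟨ ℤ.m-n≡m⊖n (a + k) b ⟨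
  (+ a +ℤ + k) -ℤ + b     ≡⟨ ℤ.+-assoc (+ a) (+ k) (neg + b) ⟩
  + a +ℤ (+ k -ℤ + b)     ≡⟨ cong (+ a +ℤ_) (ℤ.+-comm (+ k) (neg + b)) ⟩
  + a +ℤ (neg + b +ℤ + k) ≡⟨ ℤ.+-assoc (+ a) (neg + b) (+ k) ⟨
  (+ a -ℤ + b) +ℤ + k     ∎
  where open ≡-Reasoning

module _ (G : Graph n) where
  open Graph G

  Induced : Subset n → Rel (Fin n) 0ℓ
  Induced S u v = u ∈ S × v ∈ S × u ~ v

  induced? : ∀ S → Decidable (Induced S)
  induced? S u v = (u ∈? S) ×-dec (v ∈? S) ×-dec (u ~? v)

  Connected : Subset n → Set
  Connected S = ∀ u v → u ∈ S → v ∈ S → Star (Induced S) u v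

  connected? : ∀ S → Dec (Connected S)
  connected? S = allFin? λ u → allFin? λ v →
    (u ∈? S) →-dec ((v ∈? S) →-dec Reachability.star? (induced? S) u v)

  δ : Subset n → Fin n → ℕ
  δ S u = ∣ S ∩ neighbours u ∣

  -- The subtraction never truncates: see margin-exact.
  margin : Subset n → Fin n → ℕ
  margin S u = (δ S u + n) ∸ δ (∁ S) u

  margin-exact : ∀ S u → + margin S u ≡ (+ δ S u -ℤ + δ (∁ S) u) +ℤ + n
  margin-exact S u = ∸-exact (δ S u) (∣p∣≤n (∁ S ∩ neighbours u))

  f-y : Subset n → ℕ
  f-y S = minimum (map (margin S) (elements S))

  da : ℕ[x,y]
  da = X.sum (map (λ S → X.monomial (1 ·y^ f-y S) ∣ S ∣)
                  (filter (λ S → nonempty? S ×-dec connected? S) (subsets n)))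

{-# OPTIONS --safe #-}

-- Evaluated at y = 1, the coefficient of xᵏ counts the connected vertex sets of size k.
-- The coefficient of x records the degrees, since the margin of u in {u} is N - deg u.
-- It therefore yields N = n + 1, a universal vertex h, two vertices of degree 2, and degree 3
-- elsewhere.  The coefficients of xⁿ add up to n + 1, so deleting any vertex leaves G connected;
-- in particular G - h is connected.  As G - h has maximum degree 2 and an end e of degree 1,
-- the walk that starts at e and never turns back visits every vertex other than h, and each
-- vertex it leaves has all its neighbours on the walk: G - h is a path.
-- Conversely, 2 + margin = deg u + N in V ∖ {v} if u ~ v, and margin = deg u + N otherwise, so
-- the minimum over V ∖ {v} is decided by the least degree among the neighbours of v.
module Submission where

open import Defs
open import Data.Nat.Base using (ℕ; zero; suc; pred; _+_; _*_; _∸_; _≤_; _<_; _≥_; z≤n; s≤s; z<s; s≤s⁻¹; NonZero; +-0-rawMonoid)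
open import Data.Product.Base using (_×_; _,_; proj₁; proj₂; ∃)
open import Function.Bundles using (_⇔_; _↔_; Inverse; Equivalence; mk⇔; mk⤖)
open import Algebra.Bundles.Raw using (RawMonoid)
import Algebra.Lattice.Properties.BooleanAlgebra as BooleanAlgebra
import Algebra.Properties.CommutativeMonoid.Sum as Sum
import Algebra.Properties.CommutativeSemigroup as CommutativeSemigroup
open import Data.Bool.Base using (Bool; true; false; if_then_else_)
open import Data.Empty using (⊥-elim) renaming (⊥ to Empty)
open import Data.Fin.Base using (Fin; zero; suc; toℕ; fromℕ; fromℕ<; inject₁; punchIn; punchOut; splitAt) renaming (join to joinᶠ)
open import Data.Fin.Permutation using (↔⇒≡)
open import Data.Fin.Properties
  using (toℕ<n; toℕ-fromℕ; toℕ-fromℕ<; toℕ-injective; toℕ-inject₁; +↔⊎; splitAt-join; any?; injective⇒≤; ¬∀⟶∃¬; punchIn-punchOut)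
  renaming (_≟_ to _≟ᶠ_)
open import Data.Fin.Subset using (Subset; inside; outside; ⊥; ⊤; ∁; ⁅_⁆; ∣_∣; _∩_; _∈_)
open import Data.Fin.Subset.Properties
open import Data.List.Base using ([]; _∷_; _++_; map; filter; length; allFin)
open import Data.List.Extrema.Nat using (min≈v⁺; min≤⊤; v≤min⁺)
open import Data.List.Membership.Propositional using () renaming (_∈_ to _∈ᴸ_)
open import Data.List.Membership.Propositional.Properties using (∈-map⁺; ∈-filter⁺; ∈-allFin)
open import Data.List.Properties using (map-++; map-∘; map-cong)
open import Data.List.Relation.Unary.All using (All; []; _∷_; zipWith) renaming (map to mapᴬ)
import Data.List.Relation.Unary.All.Properties as All
open import Data.List.Relation.Unary.AllPairs using ([]; _∷_)
open import Data.List.Relation.Unary.Any using (here; there)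
open import Data.List.Relation.Unary.Unique.Propositional using (Unique)
open import Data.Nat.ListAction using () renaming (sum to sumᴸ)
open import Data.Nat.ListAction.Properties using (sum-++)
open import Data.Nat.Properties
open import Data.Sum.Algebra using (⊎-comm)
open import Data.Sum.Base using (_⊎_; inj₁; inj₂; swap)
open import Data.Unit.Base using (tt)
open import Data.Vec.Base using (tabulate; lookup) renaming ([] to []ᵥ; _∷_ to _∷ᵥ_)
open import Data.Vec.Properties using (lookup∘tabulate; lookup⇒[]=; []=⇒lookup) renaming (map-replicate to map-replicateᵥ)
open import Function.Base using (_∘_)
open import Function.Consequences.Propositional using (strictlySurjective⇒surjective)
open import Function.Construct.Composition using (_↔-∘_; _⇔-∘_)
open import Function.Construct.Identity using (⇔-id)
open import Function.Construct.Symmetry using (↔-sym; ⇔-sym)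
open import Function.Definitions using (Injective)
open import Function.Properties.Bijection using (⤖⇒↔)
open import Level using (Level)
open import Relation.Binary.Construct.Closure.ReflexiveTransitive using (Star; ε; _◅_; _◅◅_; reverse)
open import Relation.Binary.Definitions using (tri<; tri≈; tri>)
open import Relation.Binary.PropositionalEquality
open import Relation.Nullary.Decidable using (Dec; yes; no; does; dec-true; decidable-stable; ¬?; _×-dec_; _⊎-dec_)
open import Relation.Nullary.Negation using (¬_; contradiction)
open import Relation.Unary using (Decidable)

open CommutativeSemigroup +-commutativeSemigroup using (interchange)
open Sum +-0-commutativeMonoid
  using (sum; sum-cong-≗; sum-permute; sum-remove; sum-init-last; sum-replicate-zero; ∑-distrib-+)

private
  variable
    a b : Level
    A : Set a
    P Q : Set b
    m n N : ℕ

-- Coefficients of da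

𝟙 : Dec P → ℕ
𝟙 d = if does d then 1 else 0

𝟙-true : (d : Dec P) → P → 𝟙 d ≡ 1
𝟙-true (yes _) _ = refl
𝟙-true (no ¬p) p = contradiction p ¬p

𝟙-false : (d : Dec P) → ¬ P → 𝟙 d ≡ 0
𝟙-false (yes p) ¬p = contradiction p ¬p
𝟙-false (no _)  _  = refl

𝟙-cong : (d : Dec P) (e : Dec Q) → (P → Q) → (Q → P) → 𝟙 d ≡ 𝟙 e
𝟙-cong (yes p) e f g = sym (𝟙-true e (f p))
𝟙-cong (no ¬p) e f g = sym (𝟙-false e (¬p ∘ g))

𝟙≤1 : (d : Dec P) → 𝟙 d ≤ 1
𝟙≤1 (yes _) = ≤-refl
𝟙≤1 (no _)  = z≤n

𝟙>0 : (d : Dec P) → 0 < 𝟙 d → P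
𝟙>0 (yes p) _ = p

-- Stated for any coefficient monoid because it serves at both levels of `ℕ[y][x]`: for powers of y
-- over ℕ and for powers of x over `ℕ[y]`.
coeff-monomial : ∀ {c ℓ} (M : RawMonoid c ℓ) x d k →
                 Polynomial.coeff M k (Polynomial.monomial M x d) ≡ (if does (d ≟ k) then x else RawMonoid.ε M)
coeff-monomial M x zero    zero    = refl
coeff-monomial M x zero    (suc k) = refl
coeff-monomial M x (suc d) zero    = refl
coeff-monomial M x (suc d) (suc k) = coeff-monomial M x d k

coeff-·y^ : ∀ a d k → Y.coeff k (a ·y^ d) ≡ a * 𝟙 (d ≟ k)
coeff-·y^ a d k = trans (coeff-monomial +-0-rawMonoid a d k) (if-* (does (d ≟ k)))
  where
  if-* : ∀ b → (if b then a else 0) ≡ a * (if b then 1 else 0)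
  if-* true  = sym (*-identityʳ a)
  if-* false = sym (*-zeroʳ a)

coeff-⊕ : ∀ k p q → Y.coeff k (p ⊕ q) ≡ Y.coeff k p + Y.coeff k q
coeff-⊕ k       []      q       = refl
coeff-⊕ k       (a ∷ p) []      = sym (+-identityʳ _)
coeff-⊕ zero    (a ∷ p) (b ∷ q) = refl
coeff-⊕ (suc k) (a ∷ p) (b ∷ q) = coeff-⊕ k p q

-- An equality of lists rather than `≈`, so that an arbitrary function on `ℕ[y]` can be applied to
-- both sides.
[x^]-⊕ : ∀ k P Q → [x^ k ] (P X.⊕ Q) ≡ ([x^ k ] P) ⊕ ([x^ k ] Q)
[x^]-⊕ k       []      Q       = refl
[x^]-⊕ k       (a ∷ P) []      = sym (⊕-identityʳ _)
  where
  ⊕-identityʳ : ∀ p → p ⊕ [] ≡ p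
  ⊕-identityʳ []      = refl
  ⊕-identityʳ (_ ∷ _) = refl
[x^]-⊕ zero    (a ∷ P) (b ∷ Q) = refl
[x^]-⊕ (suc k) (a ∷ P) (b ∷ Q) = [x^]-⊕ k P Q

-- Two such maps occur, the extraction of one coefficient in y and the evaluation at y = 1.
-- Abstracting over them lets `da` be expanded once for both.
record Additive (φ : ℕ[y] → ℕ) : Set where
  field
    φ-[] : φ [] ≡ 0
    φ-⊕  : ∀ p q → φ (p ⊕ q) ≡ φ p + φ q

coeff-additive : ∀ k → Additive (Y.coeff k)
coeff-additive k = record { φ-[] = refl ; φ-⊕ = coeff-⊕ k }

-- Evaluation at y = 1.
sumᴸ-⊕ : ∀ p q → sumᴸ (p ⊕ q) ≡ sumᴸ p + sumᴸ q
sumᴸ-⊕ []      q       = refl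
sumᴸ-⊕ (a ∷ p) []      = sym (+-identityʳ _)
sumᴸ-⊕ (a ∷ p) (b ∷ q) = trans (cong (a + b +_) (sumᴸ-⊕ p q)) (interchange a b _ _)

sumᴸ-additive : Additive sumᴸ
sumᴸ-additive = record { φ-[] = refl ; φ-⊕ = sumᴸ-⊕ }

sumᴸ-·y^ : ∀ a d → sumᴸ (a ·y^ d) ≡ a
sumᴸ-·y^ a zero    = +-identityʳ a
sumᴸ-·y^ a (suc d) = sumᴸ-·y^ a d

-- Since `≈` ignores trailing zeros, the lists may differ in length; the surplus entries are then
-- all zero.
sumᴸ-≈ : ∀ {p q} → p ≈ q → sumᴸ p ≡ sumᴸ q
sumᴸ-≈ {[]}    {[]}    p≈q = refl
sumᴸ-≈ {[]}    {b ∷ q} p≈q = cong₂ _+_ (p≈q 0) (sumᴸ-≈ {[]} {q} (p≈q ∘ suc))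
sumᴸ-≈ {a ∷ p} {[]}    p≈q = cong₂ _+_ (p≈q 0) (sumᴸ-≈ {p} {[]} (p≈q ∘ suc))
sumᴸ-≈ {a ∷ p} {b ∷ q} p≈q = cong₂ _+_ (p≈q 0) (sumᴸ-≈ {p} {q} (p≈q ∘ suc))

sum-filter : ∀ {P : A → Set b} (P? : Decidable P) (g : A → ℕ) xs →
             sumᴸ (map g (filter P? xs)) ≡ sumᴸ (map (λ x → 𝟙 (P? x) * g x) xs)
sum-filter P? g []       = refl
sum-filter P? g (x ∷ xs) with does (P? x)
... | true  = cong₂ _+_ (sym (+-identityʳ (g x))) (sum-filter P? g xs)
... | false = sum-filter P? g xs

-- Sums over subsets of a given size

Σ⊆ : (Subset n → ℕ) → ℕ
Σ⊆ g = sumᴸ (map g (subsets _))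

Σ⊆-cong : {f g : Subset n → ℕ} → (∀ S → f S ≡ g S) → Σ⊆ f ≡ Σ⊆ g
Σ⊆-cong eq = cong sumᴸ (map-cong eq (subsets _))

Σ⊆-suc : (g : Subset (suc n) → ℕ) →
         Σ⊆ g ≡ Σ⊆ (g ∘ (outside ∷ᵥ_)) + Σ⊆ (g ∘ (inside ∷ᵥ_))
Σ⊆-suc {n} g = begin
  sumᴸ (map g (os ++ is))             ≡⟨ cong sumᴸ (map-++ g os is) ⟩
  sumᴸ (map g os ++ map g is)         ≡⟨ sum-++ (map g os) (map g is) ⟩
  sumᴸ (map g os) + sumᴸ (map g is)   ≡⟨ cong₂ _+_ (cong sumᴸ (map-∘ (subsets n))) (cong sumᴸ (map-∘ (subsets n))) ⟨
  Σ⊆ (g ∘ (outside ∷ᵥ_)) + Σ⊆ (g ∘ (inside ∷ᵥ_)) ∎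
  where
  open ≡-Reasoning
  os = map (outside ∷ᵥ_) (subsets n)
  is = map (inside ∷ᵥ_) (subsets n)

-- Complementation exchanges the two halves in `Σ⊆-suc`.
Σ⊆-∁ : (g : Subset n → ℕ) → Σ⊆ g ≡ Σ⊆ (g ∘ ∁)
Σ⊆-∁ {zero}  g = refl
Σ⊆-∁ {suc n} g = begin
  Σ⊆ g                                                     ≡⟨ Σ⊆-suc g ⟩
  Σ⊆ (g ∘ (outside ∷ᵥ_)) + Σ⊆ (g ∘ (inside ∷ᵥ_))           ≡⟨ +-comm (Σ⊆ (g ∘ (outside ∷ᵥ_))) _ ⟩
  Σ⊆ (g ∘ (inside ∷ᵥ_)) + Σ⊆ (g ∘ (outside ∷ᵥ_))           ≡⟨ cong₂ _+_ (Σ⊆-∁ (g ∘ (inside ∷ᵥ_))) (Σ⊆-∁ (g ∘ (outside ∷ᵥ_))) ⟩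
  Σ⊆ (g ∘ (inside ∷ᵥ_) ∘ ∁) + Σ⊆ (g ∘ (outside ∷ᵥ_) ∘ ∁)   ≡⟨ Σ⊆-suc (g ∘ ∁) ⟨
  Σ⊆ (g ∘ ∁)                                               ∎
  where open ≡-Reasoning

Σ⊆-zero : ∀ n → Σ⊆ {n} (λ _ → 0) ≡ 0
Σ⊆-zero zero    = refl
Σ⊆-zero (suc n) = trans (Σ⊆-suc {n} (λ _ → 0)) (cong₂ _+_ (Σ⊆-zero n) (Σ⊆-zero n))

Σ⊆-size-0 : (g : Subset n → ℕ) → Σ⊆ (λ S → 𝟙 (∣ S ∣ ≟ 0) * g S) ≡ g ⊥
Σ⊆-size-0 {zero}  g = trans (+-identityʳ _) (+-identityʳ _)
Σ⊆-size-0 {suc n} g = begin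
  Σ⊆ (λ S → 𝟙 (∣ S ∣ ≟ 0) * g S)  ≡⟨ Σ⊆-suc {n} _ ⟩
  -- Sets containing the first element have size a successor, so their indicator computes to 0.
  Σ⊆ (λ S → 𝟙 (∣ S ∣ ≟ 0) * g (outside ∷ᵥ S)) + Σ⊆ {n} (λ _ → 0)
    ≡⟨ cong₂ _+_ (Σ⊆-size-0 (g ∘ (outside ∷ᵥ_))) (Σ⊆-zero n) ⟩
  g ⊥ + 0  ≡⟨ +-identityʳ _ ⟩
  g ⊥      ∎
  where open ≡-Reasoning

Σ⊆-size-1 : (g : Subset n → ℕ) → Σ⊆ (λ S → 𝟙 (∣ S ∣ ≟ 1) * g S) ≡ sum (λ i → g ⁅ i ⁆)
Σ⊆-size-1 {zero}  g = refl
Σ⊆-size-1 {suc n} g = begin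
  Σ⊆ (λ S → 𝟙 (∣ S ∣ ≟ 1) * g S)  ≡⟨ Σ⊆-suc {n} _ ⟩
  Σ⊆ (λ S → 𝟙 (∣ S ∣ ≟ 1) * g (outside ∷ᵥ S)) + Σ⊆ (λ S → 𝟙 (∣ S ∣ ≟ 0) * g (inside ∷ᵥ S))
    ≡⟨ cong₂ _+_ (Σ⊆-size-1 (g ∘ (outside ∷ᵥ_))) (Σ⊆-size-0 (g ∘ (inside ∷ᵥ_))) ⟩
  sum (λ i → g ⁅ suc i ⁆) + g ⁅ zero ⁆  ≡⟨ +-comm _ (g ⁅ zero ⁆) ⟩
  sum (λ i → g ⁅ i ⁆)                   ∎
  where open ≡-Reasoning

-- Complementation trades size `k` for size `l`, so that sums over large sets reduce to sums over
-- small ones. Truncated subtraction is exact only for `c ≤ n`, hence the bound in the first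
-- hypothesis.
Σ⊆-cosize : ∀ {k l} → (∀ c → c ≤ n → n ∸ c ≡ k → c ≡ l) → n ∸ l ≡ k → (g : Subset n → ℕ) →
            Σ⊆ (λ S → 𝟙 (∣ S ∣ ≟ k) * g S) ≡ Σ⊆ (λ S → 𝟙 (∣ S ∣ ≟ l) * g (∁ S))
Σ⊆-cosize {n} {k} {l} unique n∸l≡k g = trans (Σ⊆-∁ {n} _) (Σ⊆-cong λ S →
  cong (_* g (∁ S)) (𝟙-cong (∣ ∁ S ∣ ≟ k) (∣ S ∣ ≟ l)
    (λ ∣∁S∣≡k → unique _ (∣p∣≤n S) (trans (sym (∣∁p∣≡n∸∣p∣ S)) ∣∁S∣≡k))
    (λ ∣S∣≡l → trans (∣∁p∣≡n∸∣p∣ S) (trans (cong (n ∸_) ∣S∣≡l) n∸l≡k))))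

Σ⊆-size-n : (g : Subset n → ℕ) → Σ⊆ (λ S → 𝟙 (∣ S ∣ ≟ n) * g S) ≡ g ⊤
Σ⊆-size-n {n} g = trans (Σ⊆-cosize unique refl g)
  (trans (Σ⊆-size-0 (g ∘ ∁)) (cong g (map-replicateᵥ _ outside n)))
  where
  unique : ∀ c → c ≤ n → n ∸ c ≡ n → c ≡ 0
  unique c c≤n eq = +-cancelˡ-≡ n c 0 (trans (cong (_+ c) (sym eq)) (trans (m∸n+n≡m c≤n) (sym (+-identityʳ n))))

Σ⊆-size-[n-1] : (g : Subset (suc n) → ℕ) →
                Σ⊆ (λ S → 𝟙 (∣ S ∣ ≟ n) * g S) ≡ sum (λ i → g (∁ ⁅ i ⁆))
Σ⊆-size-[n-1] {n} g = trans (Σ⊆-cosize unique refl g) (Σ⊆-size-1 (g ∘ ∁))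
  where
  unique : ∀ c → c ≤ suc n → suc n ∸ c ≡ n → c ≡ 1
  unique c c≤1+n eq = +-cancelˡ-≡ n c 1 (trans (cong (_+ c) (sym eq)) (trans (m∸n+n≡m c≤1+n) (+-comm 1 n)))

-- Additive maps applied to the coefficients of `da`

module _ (G : Graph n) {φ : ℕ[y] → ℕ} (φ-additive : Additive φ) where
  open Additive φ-additive

  admissible? : ∀ S → Dec _
  admissible? S = nonempty? S ×-dec connected? G S

  weight : Subset n → ℕ
  weight S = 𝟙 (admissible? S) * φ (1 ·y^ f-y G S)

  -- Additivity moves `φ` inside the sum. Both the filter and the choice of the power of x become
  -- indicators, so the sum ranges over all subsets and can be split by size.
  φ-da : ∀ k → φ ([x^ k ] da G) ≡ Σ⊆ (λ S → 𝟙 (∣ S ∣ ≟ k) * weight S)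
  φ-da k = begin
    φ ([x^ k ] da G)                                     ≡⟨ φ-sum (filter admissible? (subsets n)) ⟩
    sumᴸ (map (λ S → 𝟙 (∣ S ∣ ≟ k) * φ (1 ·y^ f-y G S)) (filter admissible? (subsets n)))
                                                         ≡⟨ sum-filter admissible? _ (subsets n) ⟩
    Σ⊆ (λ S → 𝟙 (admissible? S) * (𝟙 (∣ S ∣ ≟ k) * φ (1 ·y^ f-y G S)))
      ≡⟨ Σ⊆-cong (λ S → *-left-comm (𝟙 (admissible? S)) (𝟙 (∣ S ∣ ≟ k)) _) ⟩
    Σ⊆ (λ S → 𝟙 (∣ S ∣ ≟ k) * weight S)                  ∎
    where
    open ≡-Reasoning
    *-left-comm : ∀ a b c → a * (b * c) ≡ b * (a * c)
    *-left-comm a b c = trans (sym (*-assoc a b c)) (trans (cong (_* c) (*-comm a b)) (*-assoc b a c))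
    φ-if : ∀ b p → φ (if b then p else []) ≡ (if b then 1 else 0) * φ p
    φ-if true  p = sym (+-identityʳ (φ p))
    φ-if false p = φ-[]
    φ-sum : ∀ Ss → φ ([x^ k ] X.sum (map (λ S → X.monomial (1 ·y^ f-y G S) ∣ S ∣) Ss)) ≡
                   sumᴸ (map (λ S → 𝟙 (∣ S ∣ ≟ k) * φ (1 ·y^ f-y G S)) Ss)
    φ-sum []       = φ-[]
    φ-sum (S ∷ Ss) = begin
      φ ([x^ k ] (Q₀ X.⊕ Qs))            ≡⟨ cong φ ([x^]-⊕ k Q₀ Qs) ⟩
      φ (([x^ k ] Q₀) ⊕ ([x^ k ] Qs))    ≡⟨ φ-⊕ ([x^ k ] Q₀) ([x^ k ] Qs) ⟩
      φ ([x^ k ] Q₀) + φ ([x^ k ] Qs)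
        ≡⟨ cong₂ _+_ (trans (cong φ (coeff-monomial Y.rawMonoid _ ∣ S ∣ k)) (φ-if (does (∣ S ∣ ≟ k)) _)) (φ-sum Ss) ⟩
      _ ∎
      where
      Q₀  = X.monomial (1 ·y^ f-y G S) ∣ S ∣
      Qs = X.sum (map (λ S → X.monomial (1 ·y^ f-y G S) ∣ S ∣) Ss)

-- Degrees and margins

-- For `q = neighbours u` this splits the degree of `u` into its neighbours inside and outside of
-- `p`.
∣p∩q∣+∣∁p∩q∣≡∣q∣ : ∀ (p q : Subset n) → ∣ p ∩ q ∣ + ∣ ∁ p ∩ q ∣ ≡ ∣ q ∣
∣p∩q∣+∣∁p∩q∣≡∣q∣ []ᵥ            []ᵥ            = refl
∣p∩q∣+∣∁p∩q∣≡∣q∣ (inside  ∷ᵥ p) (inside  ∷ᵥ q) = cong suc (∣p∩q∣+∣∁p∩q∣≡∣q∣ p q)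
∣p∩q∣+∣∁p∩q∣≡∣q∣ (outside ∷ᵥ p) (inside  ∷ᵥ q) = trans (+-suc _ _) (cong suc (∣p∩q∣+∣∁p∩q∣≡∣q∣ p q))
∣p∩q∣+∣∁p∩q∣≡∣q∣ (inside  ∷ᵥ p) (outside ∷ᵥ q) = ∣p∩q∣+∣∁p∩q∣≡∣q∣ p q
∣p∩q∣+∣∁p∩q∣≡∣q∣ (outside ∷ᵥ p) (outside ∷ᵥ q) = ∣p∩q∣+∣∁p∩q∣≡∣q∣ p q

∣⁅x⁆∩p∣ : ∀ x (p : Subset n) → ∣ ⁅ x ⁆ ∩ p ∣ ≡ (if lookup p x then 1 else 0)
∣⁅x⁆∩p∣ {suc n} zero    (inside  ∷ᵥ p) = cong suc (trans (cong ∣_∣ (∩-zeroˡ p)) (∣⊥∣≡0 n))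
∣⁅x⁆∩p∣ {suc n} zero    (outside ∷ᵥ p) = trans (cong ∣_∣ (∩-zeroˡ p)) (∣⊥∣≡0 n)
∣⁅x⁆∩p∣ {suc n} (suc x) (_       ∷ᵥ p) = ∣⁅x⁆∩p∣ x p

∣tabulate∣ : ∀ (f : Fin n → Bool) → ∣ tabulate f ∣ ≡ sum (λ i → if f i then 1 else 0)
∣tabulate∣ {zero}  f = refl
∣tabulate∣ {suc n} f with f zero
... | true  = cong suc (∣tabulate∣ (f ∘ suc))
... | false = ∣tabulate∣ (f ∘ suc)

minimum-≡ : ∀ {v ks} → v ∈ᴸ ks → All (v ≤_) ks → minimum ks ≡ v
minimum-≡ {ks = k ∷ ks} (here refl)  (_   ∷ v≤ks) = ≤-antisym (min≤⊤ k ks) (v≤min⁺ ≤-refl v≤ks)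
minimum-≡ {ks = k ∷ ks} (there v∈ks) (v≤k ∷ v≤ks) = min≈v⁺ v∈ks v≤ks v≤k

module _ (G : Graph n) where
  open Graph G

  deg : Fin n → ℕ
  deg u = ∣ neighbours u ∣

  ~⇒∈ : ∀ {u v} → u ~ v → v ∈ neighbours u
  ~⇒∈ {u} {v} u~v = lookup⇒[]= v _ (trans (lookup∘tabulate _ v) (dec-true (u ~? v) u~v))

  ∈⇒~ : ∀ {u v} → v ∈ neighbours u → u ~ v
  ∈⇒~ {u} {v} v∈ = does-true (u ~? v) (trans (sym (lookup∘tabulate _ v)) ([]=⇒lookup v∈))
    where
    does-true : ∀ {P : Set} (d : Dec P) → does d ≡ true → P
    does-true (yes p) _ = p

  deg-sum : ∀ u → deg u ≡ sum (λ v → 𝟙 (u ~? v))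
  deg-sum u = ∣tabulate∣ (λ v → does (u ~? v))

  δ-⁅⁆ : ∀ u v → δ G ⁅ v ⁆ u ≡ 𝟙 (u ~? v)
  δ-⁅⁆ u v = trans (∣⁅x⁆∩p∣ v (neighbours u)) (cong (if_then 1 else 0) (lookup∘tabulate _ v))

  δ-∁⁅⁆ : ∀ u v → 𝟙 (u ~? v) + δ G (∁ ⁅ v ⁆) u ≡ deg u
  δ-∁⁅⁆ u v = trans (cong (_+ δ G (∁ ⁅ v ⁆) u) (sym (δ-⁅⁆ u v))) (∣p∩q∣+∣∁p∩q∣≡∣q∣ ⁅ v ⁆ (neighbours u))

  margin-⁅⁆ : ∀ u → margin G ⁅ u ⁆ u ≡ n ∸ deg u
  margin-⁅⁆ u = cong₂ (λ a b → (a + n) ∸ b) (trans (δ-⁅⁆ u u) u≁u)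
    (trans (cong (_+ δ G (∁ ⁅ u ⁆) u) (sym u≁u)) (δ-∁⁅⁆ u u))
    where
    u≁u : 𝟙 (u ~? u) ≡ 0
    u≁u = 𝟙-false (u ~? u) (irrefl refl)

  margin-⊤ : ∀ u → margin G ⊤ u ≡ deg u + n
  margin-⊤ u = cong₂ (λ a b → (a + n) ∸ b) δ⊤ (+-cancelˡ-≡ (deg u) _ 0
    (trans (cong (_+ δ G (∁ ⊤) u) (sym δ⊤)) (trans (∣p∩q∣+∣∁p∩q∣≡∣q∣ ⊤ (neighbours u)) (sym (+-identityʳ _)))))
    where
    δ⊤ : δ G ⊤ u ≡ deg u
    δ⊤ = cong ∣_∣ (∩-identityˡ (neighbours u))

  private
    -- Outside of `∁ ⁅ v ⁆` there is only `v`, so at most one edge is subtracted.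
    margin-∁⁅⁆ : ∀ u v → margin G (∁ ⁅ v ⁆) u ≡ (δ G (∁ ⁅ v ⁆) u + n) ∸ 𝟙 (u ~? v)
    margin-∁⁅⁆ u v = let open BooleanAlgebra (∪-∩-booleanAlgebra n) in cong (δ G (∁ ⁅ v ⁆) u + n ∸_)
      (trans (cong (λ S → δ G S u) (¬-involutive ⁅ v ⁆)) (δ-⁅⁆ u v))

  margin-∁⁅⁆-≁ : ∀ {u v} → ¬ u ~ v → margin G (∁ ⁅ v ⁆) u ≡ deg u + n
  margin-∁⁅⁆-≁ {u} {v} u≁v = begin
    margin G (∁ ⁅ v ⁆) u                   ≡⟨ margin-∁⁅⁆ u v ⟩
    δ G (∁ ⁅ v ⁆) u + n ∸ 𝟙 (u ~? v)       ≡⟨ cong (δ G (∁ ⁅ v ⁆) u + n ∸_) 𝟙≡0 ⟩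
    δ G (∁ ⁅ v ⁆) u + n                    ≡⟨ cong (λ k → k + δ G (∁ ⁅ v ⁆) u + n) 𝟙≡0 ⟨
    𝟙 (u ~? v) + δ G (∁ ⁅ v ⁆) u + n       ≡⟨ cong (_+ n) (δ-∁⁅⁆ u v) ⟩
    deg u + n                              ∎
    where
    open ≡-Reasoning
    𝟙≡0 = 𝟙-false (u ~? v) u≁v

  -- The edge to `v` is lost on the inside and counted on the outside, a loss of two. Adding 2 on
  -- the left avoids truncated subtraction.
  margin-∁⁅⁆-~ : ∀ {u v} → u ~ v → 2 + margin G (∁ ⁅ v ⁆) u ≡ deg u + n
  margin-∁⁅⁆-~ {u} {v} u~v = begin
    2 + margin G (∁ ⁅ v ⁆) u               ≡⟨ cong (2 +_) (margin-∁⁅⁆ u v) ⟩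
    2 + (δ G (∁ ⁅ v ⁆) u + n ∸ 𝟙 (u ~? v)) ≡⟨ cong (λ k → 2 + (δ G (∁ ⁅ v ⁆) u + n ∸ k)) 𝟙≡1 ⟩
    2 + (δ G (∁ ⁅ v ⁆) u + n ∸ 1)          ≡⟨ cong suc (m+[n∸m]≡n (≤-trans (≤-trans (s≤s z≤n) (toℕ<n u)) (m≤n+m n _))) ⟩
    1 + δ G (∁ ⁅ v ⁆) u + n                ≡⟨ cong (λ k → k + δ G (∁ ⁅ v ⁆) u + n) 𝟙≡1 ⟨
    𝟙 (u ~? v) + δ G (∁ ⁅ v ⁆) u + n       ≡⟨ cong (_+ n) (δ-∁⁅⁆ u v) ⟩
    deg u + n                              ∎
    where
    open ≡-Reasoning
    𝟙≡1 = 𝟙-true (u ~? v) u~v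

  f-y-≡ : ∀ {S u} → u ∈ S → (∀ {w} → w ∈ S → margin G S u ≤ margin G S w) → f-y G S ≡ margin G S u
  f-y-≡ {S} {u} u∈S least = minimum-≡ (∈-map⁺ (margin G S) (∈-filter⁺ (_∈? S) (∈-allFin u) u∈S))
    (All.map⁺ (mapᴬ least (All.all-filter (_∈? S) (allFin n))))

  f-y-⁅⁆ : ∀ u → f-y G ⁅ u ⁆ ≡ n ∸ deg u
  f-y-⁅⁆ u = trans (f-y-≡ (x∈⁅x⁆ u) (λ w∈ → ≤-reflexive (cong (margin G ⁅ u ⁆) (sym (x∈⁅y⁆⇒x≡y u w∈))))) (margin-⁅⁆ u)

  singleton-connected : ∀ u → Connected G ⁅ u ⁆
  singleton-connected u v w v∈ w∈ with refl ← x∈⁅y⁆⇒x≡y u v∈ | refl ← x∈⁅y⁆⇒x≡y u w∈ = ε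

  -- Any two vertices are joined through `h`.
  universal⇒connected : ∀ {h S} → h ∈ S → (∀ {v} → h ≢ v → h ~ v) → Connected G S
  universal⇒connected {h} {S} h∈S h~ u v u∈S v∈S = to-h ◅◅ from-h
    where
    to-h : Star (Induced G S) u h
    to-h with h ≟ᶠ u
    ... | yes refl = ε
    ... | no h≢u   = (u∈S , h∈S , ~-sym (h~ h≢u)) ◅ ε
    from-h : Star (Induced G S) h v
    from-h with h ≟ᶠ v
    ... | yes refl = ε
    ... | no h≢v   = (h∈S , v∈S , h~ h≢v) ◅ ε

  module _ {φ : ℕ[y] → ℕ} (φ-additive : Additive φ) where

    weight-connected : ∀ {S u k} → u ∈ S → Connected G S → f-y G S ≡ k → weight G φ-additive S ≡ φ (1 ·y^ k)
    weight-connected {S} {u} u∈S conn refl =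
      trans (cong (_* φ (1 ·y^ f-y G S)) (𝟙-true (admissible? G φ-additive S) ((u , u∈S) , conn))) (+-identityʳ _)

    φ-da-1 : φ ([x^ 1 ] da G) ≡ sum (λ u → φ (1 ·y^ (n ∸ deg u)))
    φ-da-1 = trans (φ-da G φ-additive 1) (trans (Σ⊆-size-1 (weight G φ-additive))
      (sum-cong-≗ λ u → weight-connected (x∈⁅x⁆ u) (singleton-connected u) (f-y-⁅⁆ u)))

    φ-da-n : φ ([x^ n ] da G) ≡ weight G φ-additive ⊤
    φ-da-n = trans (φ-da G φ-additive n) (Σ⊆-size-n (weight G φ-additive))

φ-da-[n-1] : ∀ (G : Graph (suc n)) {φ : ℕ[y] → ℕ} (φ-additive : Additive φ) →
             φ ([x^ n ] da G) ≡ sum (λ v → weight G φ-additive (∁ ⁅ v ⁆))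
φ-da-[n-1] {n} G φ-additive = trans (φ-da G φ-additive n) (Σ⊆-size-[n-1] (weight G φ-additive))

-- Graph isomorphisms

≅-sym : ∀ {G : Graph m} {H : Graph n} → G ≅ H → H ≅ G
≅-sym {G = G} {H} iso = record
  { bijection = ↔-sym bijection
  ; adjacency = λ {u} {v} → ⇔-sym (subst₂ (λ x y → (from u G.~ from v) ⇔ (x H.~ y))
                              (strictlyInverseˡ u) (strictlyInverseˡ v) adjacency)
  }
  where
  module G = Graph G
  module H = Graph H
  open _≅_ iso
  open Inverse bijection using (strictlyInverseˡ)

≅-trans : ∀ {k} {F : Graph k} {G : Graph m} {H : Graph n} → F ≅ G → G ≅ H → F ≅ H
≅-trans i j = record
  { bijection = _≅_.bijection j ↔-∘ _≅_.bijection i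
  ; adjacency = _≅_.adjacency j ⇔-∘ _≅_.adjacency i
  }

-- Mediates between `openWheel`, where the hub is the last vertex, and `fan`, where it is the first.
join-comm : (G : Graph m) (H : Graph n) → join G H ≅ join H G
join-comm {m} {n} G H = record
  { bijection = ↔-sym (+↔⊎ {n} {m}) ↔-∘ (⊎-comm _ _ ↔-∘ +↔⊎ {m} {n})
  ; adjacency = λ {u} {v} → adj (splitAt m u) (splitAt m v)
  }
  where
  swap-adj : ∀ s t → JoinAdjacent G H s t ⇔ JoinAdjacent H G (swap s) (swap t)
  swap-adj (inj₁ _) (inj₁ _) = ⇔-id _
  swap-adj (inj₁ _) (inj₂ _) = ⇔-id _
  swap-adj (inj₂ _) (inj₁ _) = ⇔-id _
  swap-adj (inj₂ _) (inj₂ _) = ⇔-id _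
  adj : ∀ s t → JoinAdjacent G H s t ⇔
        JoinAdjacent H G (splitAt n (joinᶠ n m (swap s))) (splitAt n (joinᶠ n m (swap t)))
  adj s t = subst₂ (λ x y → JoinAdjacent G H s t ⇔ JoinAdjacent H G x y)
    (sym (splitAt-join n m (swap s))) (sym (splitAt-join n m (swap t))) (swap-adj s t)

-- A degree is a sum of adjacency indicators, and such a sum can be reindexed along the bijection.
deg-≅ : ∀ {G : Graph m} {H : Graph n} (iso : G ≅ H) u → deg H (_≅_.to iso u) ≡ deg G u
deg-≅ {G = G} {H} iso u = begin
  deg H (to u)                        ≡⟨ deg-sum H (to u) ⟩
  sum (λ v → 𝟙 (to u H.~? v))         ≡⟨ sum-permute _ bijection ⟩
  sum (λ v → 𝟙 (to u H.~? to v))      ≡⟨ sum-cong-≗ (λ v → 𝟙-cong (to u H.~? to v) (u G.~? v)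
                                          (Equivalence.from adjacency) (Equivalence.to adjacency)) ⟩
  sum (λ v → 𝟙 (u G.~? v))            ≡⟨ deg-sum G u ⟨
  deg G u                             ∎
  where
  module G = Graph G
  module H = Graph H
  open _≅_ iso
  open ≡-Reasoning

-- The coefficients of the fan

sum-const : ∀ n x → sum {n} (λ _ → x) ≡ n * x
sum-const zero    x = refl
sum-const (suc n) x = cong (x +_) (sum-const n x)

-- Fits the degrees along the rim, where the two ends are exceptional. `2 ≤ n` keeps the ends
-- distinct.
sum-ends : ∀ {x y} → 2 ≤ n → (t : Fin n → ℕ) →
           (∀ i → toℕ i ≡ 0 → t i ≡ x) → (∀ i → 1 + toℕ i ≡ n → t i ≡ x) →
           (∀ i → 0 < toℕ i → 1 + toℕ i < n → t i ≡ y) → sum t ≡ 2 * x + (n ∸ 2) * y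
sum-ends {x = x} {y} (s≤s (s≤s {n = k} z≤n)) t first last inner = begin
  t zero + sum (t ∘ suc)       ≡⟨ cong (t zero +_) (sum-init-last (t ∘ suc)) ⟩
  t zero + (sum {k} (λ i → t (suc (inject₁ i))) + t (fromℕ (suc k)))
    ≡⟨ cong₂ _+_ (first zero refl) (cong₂ _+_ (trans (sum-cong-≗ inner′) (sum-const k y))
        (last (fromℕ (suc k)) (cong (2 +_) (toℕ-fromℕ k)))) ⟩
  x + (k * y + x)              ≡⟨ cong (x +_) (+-comm (k * y) x) ⟩
  x + (x + k * y)              ≡⟨ +-assoc x x (k * y) ⟨
  x + x + k * y                ≡⟨ cong (λ z → x + z + k * y) (+-identityʳ x) ⟨
  2 * x + k * y                ∎
  where
  open ≡-Reasoning
  inner′ : ∀ i → t (suc (inject₁ i)) ≡ y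
  inner′ i = inner _ z<s (s≤s (s≤s (≤-trans (≤-reflexive (cong suc (toℕ-inject₁ i))) (toℕ<n i))))

-- Fits the deletion of one rim vertex, where the neighbours of the ends are exceptional. For
-- `4 ≤ n` they are distinct; removing the two outer terms leaves a case of `sum-ends`.
sum-next-to-ends : ∀ {x y} → 4 ≤ n → (t : Fin n → ℕ) →
                   (∀ i → toℕ i ≡ 1 → t i ≡ x) → (∀ i → 2 + toℕ i ≡ n → t i ≡ x) →
                   (∀ i → toℕ i ≢ 1 → 2 + toℕ i ≢ n → t i ≡ y) → sum t ≡ 2 * x + (n ∸ 2) * y
sum-next-to-ends {x = x} {y} (s≤s (s≤s (s≤s (s≤s {n = k} z≤n)))) t second penultimate other = begin
  t zero + sum (t ∘ suc)       ≡⟨ cong (t zero +_) (sum-init-last (t ∘ suc)) ⟩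
  t zero + (sum {2 + k} (λ i → t (suc (inject₁ i))) + t (fromℕ (3 + k)))
    ≡⟨ cong₂ _+_ (other zero (λ ()) (λ ())) (cong₂ _+_
         (sum-ends (s≤s (s≤s z≤n)) (λ i → t (suc (inject₁ i)))
           (λ i i≡0 → second _ (cong suc (trans (toℕ-inject₁ i) i≡0)))
           (λ i i≡k → penultimate _ (cong (2 +_) (trans (cong suc (toℕ-inject₁ i)) i≡k)))
           (λ i 0<i i<k → other _
             (λ eq → <-irrefl (sym (trans (sym (toℕ-inject₁ i)) (suc-injective eq))) 0<i)
             (λ eq → <-irrefl (trans (cong suc (sym (toℕ-inject₁ i))) (suc-injective (suc-injective eq))) i<k)))
         (other (fromℕ (3 + k)) (λ ()) λ eq → 1+n≢n (trans (cong (4 +_) (sym (toℕ-fromℕ k))) (suc-injective eq)))) ⟩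
  y + (2 * x + k * y + y)      ≡⟨ cong (y +_) (trans (+-assoc (2 * x) (k * y) y) (cong (2 * x +_) (+-comm (k * y) y))) ⟩
  y + (2 * x + (y + k * y))    ≡⟨ +-assoc y (2 * x) _ ⟨
  y + 2 * x + (y + k * y)      ≡⟨ cong (_+ (y + k * y)) (+-comm y (2 * x)) ⟩
  2 * x + y + (y + k * y)      ≡⟨ +-assoc (2 * x) y _ ⟩
  2 * x + (2 + k) * y          ∎
  where open ≡-Reasoning

sum-≟ : ∀ n a → sum {n} (λ j → 𝟙 (a ≟ toℕ j)) ≡ 𝟙 (a <? n)
sum-≟ zero    a       = refl
sum-≟ (suc n) zero    = cong suc (sum-replicate-zero n)
sum-≟ (suc n) (suc a) = trans (sum-≟ n a) (𝟙-cong (a <? n) (suc a <? suc n) s≤s s≤s⁻¹)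

-- The hub is vertex zero.
fan : ∀ n → Graph (1 + n)
fan n = join (complete 1) (path n)

deg-hub : deg (fan n) zero ≡ n
deg-hub {n} = trans (deg-sum (fan n) zero) (trans (sum-const n 1) (*-identityʳ n))

-- A vertex has a successor unless it is last and a predecessor unless it is first. No vertex is
-- both at once, so the indicator of the disjunction is a sum.
deg-path : ∀ i → deg (path n) i ≡ 𝟙 (suc (toℕ i) <? n) + 𝟙 (0 <? toℕ i)
deg-path {n} i = begin
  deg (path n) i                                   ≡⟨ deg-sum (path n) i ⟩
  sum (λ j → 𝟙 (next? j ⊎-dec prev? j))            ≡⟨ sum-cong-≗ (λ j → 𝟙-⊎ (next? j) (prev? j) exclusive) ⟩
  sum (λ j → 𝟙 (next? j) + 𝟙 (prev? j))            ≡⟨ ∑-distrib-+ (𝟙 ∘ next?) (𝟙 ∘ prev?) ⟩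
  sum (𝟙 ∘ next?) + sum (𝟙 ∘ prev?)                ≡⟨ cong₂ _+_ (sum-≟ n (suc (toℕ i))) (sum-prev (toℕ i) (toℕ<n i)) ⟩
  𝟙 (suc (toℕ i) <? n) + 𝟙 (0 <? toℕ i)            ∎
  where
  open ≡-Reasoning
  next? : ∀ (j : Fin n) → Dec (suc (toℕ i) ≡ toℕ j)
  next? j = suc (toℕ i) ≟ toℕ j
  prev? : ∀ (j : Fin n) → Dec (suc (toℕ j) ≡ toℕ i)
  prev? j = suc (toℕ j) ≟ toℕ i
  exclusive : ∀ {a b} → suc a ≡ b → ¬ (suc b ≡ a)
  exclusive p q = <-asym (≤-reflexive p) (≤-reflexive q)
  𝟙-⊎ : ∀ {P Q : Set} (p? : Dec P) (q? : Dec Q) → (P → ¬ Q) → 𝟙 (p? ⊎-dec q?) ≡ 𝟙 p? + 𝟙 q?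
  𝟙-⊎ (yes p) q? p⇒¬q = cong suc (sym (𝟙-false q? (p⇒¬q p)))
  𝟙-⊎ (no _)  q? _    = refl
  sum-prev : ∀ a → a < n → sum {n} (λ j → 𝟙 (suc (toℕ j) ≟ a)) ≡ 𝟙 (0 <? a)
  sum-prev zero    _   = sum-replicate-zero n
  sum-prev (suc a) a<n = trans (sum-cong-≗ {n} (λ j → 𝟙-cong (toℕ j ≟ a) (a ≟ toℕ j) sym sym))
    (trans (sum-≟ n a) (𝟙-true (a <? n) (<⇒≤ a<n)))

deg-rim : ∀ i → deg (fan n) (suc i) ≡ suc (deg (path n) i)
deg-rim {n} i = trans (deg-sum (fan n) (suc i)) (cong suc (sym (deg-sum (path n) i)))

module _ (G : Graph n) where
  open Graph G

  ~⇒∈∁⁅⁆ : ∀ {u v} → u ~ v → u ∈ ∁ ⁅ v ⁆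
  ~⇒∈∁⁅⁆ {u} {v} u~v = x∉p⇒x∈∁p λ u∈ → irrefl (x∈⁅y⁆⇒x≡y v u∈) u~v

module _ (G : Graph n) (deg≥2 : ∀ u → 2 ≤ deg G u) where
  open Graph G

  private
    margin-∁⁅⁆≥ : ∀ v w → n ≤ margin G (∁ ⁅ v ⁆) w
    margin-∁⁅⁆≥ v w with w ~? v
    ... | yes w~v = +-cancelˡ-≤ 2 _ _ (≤-trans (+-monoˡ-≤ n (deg≥2 w)) (≤-reflexive (sym (margin-∁⁅⁆-~ G w~v))))
    ... | no w≁v  = ≤-trans (m≤n+m n _) (≤-reflexive (sym (margin-∁⁅⁆-≁ G w≁v)))

  -- With all degrees at least 2, no margin drops below `n`, and a neighbour of `v` of degree 2
  -- attains this bound.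
  f-y-∁⁅⁆-deg-2 : ∀ {u v} → u ~ v → deg G u ≡ 2 → f-y G (∁ ⁅ v ⁆) ≡ n
  f-y-∁⁅⁆-deg-2 {u} {v} u~v deg≡2 = trans
    (f-y-≡ G (~⇒∈∁⁅⁆ G u~v) (λ {w} _ → ≤-trans (≤-reflexive margin≡n) (margin-∁⁅⁆≥ v w))) margin≡n
    where
    margin≡n : margin G (∁ ⁅ v ⁆) u ≡ n
    margin≡n = +-cancelˡ-≡ 2 _ _ (trans (margin-∁⁅⁆-~ G u~v) (cong (_+ n) deg≡2))

  -- Vertices not adjacent to `v` keep a margin of at least `2 + n`, so the neighbours of `v` decide
  -- the minimum.
  f-y-∁⁅⁆-deg-3 : ∀ {u v} → u ~ v → deg G u ≡ 3 → (∀ {w} → w ~ v → 3 ≤ deg G w) → f-y G (∁ ⁅ v ⁆) ≡ 1 + n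
  f-y-∁⁅⁆-deg-3 {u} {v} u~v deg≡3 deg≥3 = trans
    (f-y-≡ G (~⇒∈∁⁅⁆ G u~v) (λ {w} _ → ≤-trans (≤-reflexive margin≡1+n) (margin≥ w))) margin≡1+n
    where
    margin≡1+n : margin G (∁ ⁅ v ⁆) u ≡ 1 + n
    margin≡1+n = +-cancelˡ-≡ 2 _ _ (trans (margin-∁⁅⁆-~ G u~v) (cong (_+ n) deg≡3))
    margin≥ : ∀ w → 1 + n ≤ margin G (∁ ⁅ v ⁆) w
    margin≥ w with w ~? v
    ... | yes w~v = +-cancelˡ-≤ 2 _ _ (≤-trans (+-monoˡ-≤ n (deg≥3 w~v)) (≤-reflexive (sym (margin-∁⁅⁆-~ G w~v))))
    ... | no w≁v  = ≤-trans (+-monoˡ-≤ n (≤-trans (n≤1+n 1) (deg≥2 w))) (≤-reflexive (sym (margin-∁⁅⁆-≁ G w≁v)))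

-- The coefficients are computed in `G` itself, with its vertices named through `iso`, rather than
-- in `fan n` and then transported.
module FanCoefficients (4≤n : 4 ≤ n) (G : Graph (suc n)) (iso : fan n ≅ G) where
  open Graph G
  open _≅_ iso
  open Inverse bijection using (strictlyInverseˡ)

  hub : Fin (suc n)
  hub = to zero

  rim : Fin n → Fin (suc n)
  rim i = to (suc i)

  hub~rim : ∀ i → hub ~ rim i
  hub~rim i = Equivalence.to (adjacency {zero} {suc i}) tt

  data Vertex : Fin (suc n) → Set where
    isHub : Vertex hub
    isRim : ∀ i → Vertex (rim i)

  vertex : ∀ u → Vertex u
  vertex u with from u | strictlyInverseˡ u
  ... | zero  | refl = isHub
  ... | suc i | refl = isRim i

  rim~⁺ : ∀ {i j} → Graph._~_ (path n) i j → rim i ~ rim j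
  rim~⁺ {i} {j} = Equivalence.to (adjacency {suc i} {suc j})

  rim~⁻ : ∀ {i j} → rim i ~ rim j → Graph._~_ (path n) i j
  rim~⁻ {i} {j} = Equivalence.from (adjacency {suc i} {suc j})

  hub-universal : ∀ {v} → hub ≢ v → hub ~ v
  hub-universal {v} hub≢v with vertex v
  ... | isHub   = contradiction refl hub≢v
  ... | isRim i = hub~rim i

  deg-G-hub : deg G hub ≡ n
  deg-G-hub = trans (deg-≅ iso zero) deg-hub

  deg-G-rim : ∀ i → deg G (rim i) ≡ suc (𝟙 (suc (toℕ i) <? n) + 𝟙 (0 <? toℕ i))
  deg-G-rim i = trans (deg-≅ iso (suc i)) (trans (deg-rim i) (cong suc (deg-path i)))

  deg-first : ∀ i → toℕ i ≡ 0 → deg G (rim i) ≡ 2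
  deg-first i i≡0 = trans (deg-G-rim i) (cong₂ (λ a b → suc (a + b))
    (𝟙-true (suc (toℕ i) <? n) (≤-trans (≤-reflexive (cong (2 +_) i≡0)) (≤-trans (m≤m+n 2 2) 4≤n)))
    (𝟙-false (0 <? toℕ i) λ 0<i → <-irrefl (sym i≡0) 0<i))

  deg-last : ∀ i → 1 + toℕ i ≡ n → deg G (rim i) ≡ 2
  deg-last i i≡n-1 = trans (deg-G-rim i) (cong₂ (λ a b → suc (a + b))
    (𝟙-false (suc (toℕ i) <? n) (<-irrefl i≡n-1))
    (𝟙-true (0 <? toℕ i) (s≤s⁻¹ (≤-trans (≤-trans (m≤m+n 2 2) 4≤n) (≤-reflexive (sym i≡n-1))))))

  deg-inner : ∀ i → 0 < toℕ i → 1 + toℕ i < n → deg G (rim i) ≡ 3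
  deg-inner i 0<i i<n-1 = trans (deg-G-rim i) (cong₂ (λ a b → suc (a + b))
    (𝟙-true (suc (toℕ i) <? n) i<n-1) (𝟙-true (0 <? toℕ i) 0<i))

  deg-rim-cases : ∀ i → (toℕ i ≡ 0 ⊎ 1 + toℕ i ≡ n) ⊎ deg G (rim i) ≡ 3
  deg-rim-cases i with toℕ i ≟ 0 | suc (toℕ i) ≟ n
  ... | yes i≡0 | _         = inj₁ (inj₁ i≡0)
  ... | no _    | yes i≡n-1 = inj₁ (inj₂ i≡n-1)
  ... | no i≢0  | no i≢n-1  = inj₂ (deg-inner i (n≢0⇒n>0 i≢0) (≤∧≢⇒< (toℕ<n i) i≢n-1))

  deg≥2 : ∀ u → 2 ≤ deg G u
  deg≥2 u with vertex u
  ... | isHub = ≤-trans (≤-trans (m≤m+n 2 2) 4≤n) (≤-reflexive (sym deg-G-hub))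
  ... | isRim i with deg-rim-cases i
  ...   | inj₁ (inj₁ i≡0)   = ≤-reflexive (sym (deg-first i i≡0))
  ...   | inj₁ (inj₂ i≡n-1) = ≤-reflexive (sym (deg-last i i≡n-1))
  ...   | inj₂ deg≡3        = ≤-trans (n≤1+n 2) (≤-reflexive (sym deg≡3))

  sum-vertices : ∀ t → sum t ≡ t hub + sum (t ∘ rim)
  sum-vertices t = sum-permute t bijection

  module _ {φ : ℕ[y] → ℕ} (φ-additive : Additive φ) where

    -- The exponent is n + 1 minus the degree: 1 for the hub, n - 1 for the two ends of the rim, n -
    -- 2 for the inner rim vertices.
    φ-singletons : φ ([x^ 1 ] da G) ≡ φ (1 ·y^ 1) + (2 * φ (1 ·y^ (n ∸ 1)) + (n ∸ 2) * φ (1 ·y^ (n ∸ 2)))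
    φ-singletons = trans (φ-da-1 G φ-additive) (trans (sum-vertices t) (cong₂ _+_
      (trans (t≡ hub deg-G-hub) (cong (λ k → φ (1 ·y^ k)) (m+n∸n≡m 1 n)))
      (sum-ends (≤-trans (m≤m+n 2 2) 4≤n) (t ∘ rim)
        (λ i i≡0 → t≡ (rim i) (deg-first i i≡0))
        (λ i i≡n-1 → t≡ (rim i) (deg-last i i≡n-1))
        (λ i 0<i i<n-1 → t≡ (rim i) (deg-inner i 0<i i<n-1)))))
      where
      t : Fin (suc n) → ℕ
      t u = φ (1 ·y^ (suc n ∸ deg G u))
      t≡ : ∀ u {d} → deg G u ≡ d → t u ≡ φ (1 ·y^ (suc n ∸ d))
      t≡ u = cong (λ d → φ (1 ·y^ (suc n ∸ d)))

    -- The least degree is 2, attained at an end of the rim, and in the whole vertex set the margin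
    -- is the degree plus n + 1.
    φ-all : φ ([x^ suc n ] da G) ≡ φ (1 ·y^ (3 + n))
    φ-all = trans (φ-da-n G φ-additive) (weight-connected G φ-additive (∈⊤ {x = first})
      (universal⇒connected G ∈⊤ hub-universal)
      (trans (f-y-≡ G (∈⊤ {x = first}) (λ {w} _ → subst₂ _≤_ (sym margin-first) (sym (margin-⊤ G w)) (+-monoˡ-≤ (suc n) (deg≥2 w)))) margin-first))
      where
      0<n = ≤-trans (m≤m+n 1 3) 4≤n
      first = rim (fromℕ< 0<n)
      margin-first : margin G ⊤ first ≡ 3 + n
      margin-first = trans (margin-⊤ G first) (cong (_+ suc n) (deg-first _ (toℕ-fromℕ< 0<n)))

    private
      rim∈ : ∀ i → rim i ∈ ∁ ⁅ hub ⁆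
      rim∈ i = ~⇒∈∁⁅⁆ G (~-sym (hub~rim i))

      0<n : 0 < n
      0<n = ≤-trans (m≤m+n 1 3) 4≤n

      first : Fin n
      first = fromℕ< 0<n

      toℕ-first : toℕ first ≡ 0
      toℕ-first = toℕ-fromℕ< 0<n

      -- Walks along the rim position by position, which avoids the hub.
      from-first : ∀ k i → toℕ i ≡ k → Star (Induced G (∁ ⁅ hub ⁆)) (rim first) (rim i)
      from-first zero    i i≡0   with refl ← toℕ-injective (trans toℕ-first (sym i≡0)) = ε
      from-first (suc k) i i≡1+k = from-first k j (toℕ-fromℕ< k<n) ◅◅
        (rim∈ j , rim∈ i , rim~⁺ {j} {i} (inj₁ (trans (cong suc (toℕ-fromℕ< k<n)) (sym i≡1+k)))) ◅ ε
        where
        k<n = ≤-trans (≤-reflexive (sym i≡1+k)) (<⇒≤ (toℕ<n i))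
        j   = fromℕ< k<n

      connected-∁hub : Connected G (∁ ⁅ hub ⁆)
      connected-∁hub u v u∈ v∈ with vertex u | vertex v
      ... | isHub   | _       = contradiction (x∈⁅x⁆ hub) (x∈∁p⇒x∉p u∈)
      ... | isRim _ | isHub   = contradiction (x∈⁅x⁆ hub) (x∈∁p⇒x∉p v∈)
      ... | isRim i | isRim j =
        reverse (λ (a , b , a~b) → b , a , ~-sym a~b) (from-first _ i refl) ◅◅ from-first _ j refl

      -- The hub, the second and the penultimate rim vertex are each adjacent to an end of the rim,
      -- whose degree is 2. Their deletions give the coefficient 3 of the lower power of y.
      f-y-∁hub : f-y G (∁ ⁅ hub ⁆) ≡ 1 + n
      f-y-∁hub = f-y-∁⁅⁆-deg-2 G deg≥2 (~-sym (hub~rim first)) (deg-first first toℕ-first)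

      f-y-∁second : ∀ i → toℕ i ≡ 1 → f-y G (∁ ⁅ rim i ⁆) ≡ 1 + n
      f-y-∁second i i≡1 = f-y-∁⁅⁆-deg-2 G deg≥2
        (rim~⁺ {first} {i} (inj₁ (trans (cong suc toℕ-first) (sym i≡1)))) (deg-first first toℕ-first)

      f-y-∁penultimate : ∀ i → 2 + toℕ i ≡ n → f-y G (∁ ⁅ rim i ⁆) ≡ 1 + n
      f-y-∁penultimate i i≡n-2 = f-y-∁⁅⁆-deg-2 G deg≥2
        (rim~⁺ {j} {i} (inj₂ (sym (toℕ-fromℕ< 1+i<n)))) (deg-last j (trans (cong suc (toℕ-fromℕ< 1+i<n)) i≡n-2))
        where
        1+i<n : suc (toℕ i) < n
        1+i<n = ≤-reflexive i≡n-2
        j = fromℕ< 1+i<n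

      -- All neighbours of such a rim vertex have degree at least 3, and an inner rim neighbour has
      -- degree exactly 3.
      f-y-∁other : ∀ i → toℕ i ≢ 1 → 2 + toℕ i ≢ n → f-y G (∁ ⁅ rim i ⁆) ≡ 2 + n
      f-y-∁other i i≢1 i≢n-2 = f-y-∁⁅⁆-deg-3 G deg≥2 (rim~⁺ {j} {i} j~i) (deg-inner j 0<j j<n-1) deg≥3
        where
        -- The successor of `i` serves unless `i` is last; then its predecessor does, which is not
        -- the first vertex because `4 ≤ n`.
        inner-neighbour : ∃ λ j → Graph._~_ (path n) j i × 0 < toℕ j × 1 + toℕ j < n
        inner-neighbour with suc (toℕ i) ≟ n
        ... | no i≢n-1  = j , inj₂ (sym j≡1+i) , subst (0 <_) (sym j≡1+i) z<s ,
                          subst (λ k → suc k < n) (sym j≡1+i) (≤∧≢⇒< 1+i<n i≢n-2)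
          where
          1+i<n = ≤∧≢⇒< (toℕ<n i) i≢n-1
          j     = fromℕ< 1+i<n
          j≡1+i = toℕ-fromℕ< 1+i<n
        ... | yes i≡n-1 with toℕ i | i≡n-1 | ≤-trans 4≤n (≤-reflexive (sym i≡n-1))
        ...   | suc k | 2+k≡n | s≤s 3≤1+k = fromℕ< k<n , inj₁ (cong suc j≡k) ,
                subst (0 <_) (sym j≡k) (s≤s⁻¹ (≤-trans (n≤1+n 2) 3≤1+k)) ,
                subst (λ k → suc k < n) (sym j≡k) (≤-reflexive 2+k≡n)
          where
          k<n = ≤-trans (n≤1+n _) (≤-reflexive 2+k≡n)
          j≡k = toℕ-fromℕ< k<n
        j = proj₁ inner-neighbour
        j~i = proj₁ (proj₂ inner-neighbour)
        0<j = proj₁ (proj₂ (proj₂ inner-neighbour))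
        j<n-1 = proj₂ (proj₂ (proj₂ inner-neighbour))
        -- An end of the rim adjacent to `rim i` would make `i` second or penultimate.
        deg≥3 : ∀ {w} → w ~ rim i → 3 ≤ deg G w
        deg≥3 {w} w~i with vertex w
        ... | isHub   = ≤-trans (≤-trans (m≤m+n 3 1) 4≤n) (≤-reflexive (sym deg-G-hub))
        ... | isRim k with deg-rim-cases k | rim~⁻ {k} {i} w~i
        ...   | inj₁ (inj₁ k≡0)   | inj₁ 1+k≡i = contradiction (trans (sym 1+k≡i) (cong suc k≡0)) i≢1
        ...   | inj₁ (inj₁ k≡0)   | inj₂ 1+i≡k = contradiction (trans 1+i≡k k≡0) λ ()
        ...   | inj₁ (inj₂ k≡n-1) | inj₁ 1+k≡i = contradiction (toℕ<n i) (<-irrefl (trans (sym 1+k≡i) k≡n-1))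
        ...   | inj₁ (inj₂ k≡n-1) | inj₂ 1+i≡k = contradiction (trans (cong suc 1+i≡k) k≡n-1) i≢n-2
        ...   | inj₂ deg≡3        | _          = ≤-reflexive (sym deg≡3)

    -- Without the hub the rim is still a path; without a rim vertex the hub still joins everything.
    -- Hence every deletion contributes.
    φ-cosingletons : φ ([x^ n ] da G) ≡ φ (1 ·y^ (1 + n)) + (2 * φ (1 ·y^ (1 + n)) + (n ∸ 2) * φ (1 ·y^ (2 + n)))
    φ-cosingletons = trans (φ-da-[n-1] G φ-additive) (trans (sum-vertices t) (cong₂ _+_
      (weight-connected G φ-additive (rim∈ first) connected-∁hub f-y-∁hub)
      (sum-next-to-ends 4≤n (t ∘ rim)
        (λ i i≡1 → t≡ i (f-y-∁second i i≡1))
        (λ i i≡n-2 → t≡ i (f-y-∁penultimate i i≡n-2))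
        (λ i i≢1 i≢n-2 → t≡ i (f-y-∁other i i≢1 i≢n-2)))))
      where
      t : Fin (suc n) → ℕ
      t v = weight G φ-additive (∁ ⁅ v ⁆)
      t≡ : ∀ i {k} → f-y G (∁ ⁅ rim i ⁆) ≡ k → t (rim i) ≡ φ (1 ·y^ k)
      t≡ i = weight-connected G φ-additive hub∈ (universal⇒connected G hub∈ hub-universal)
        where
        hub∈ : hub ∈ ∁ ⁅ rim i ⁆
        hub∈ = ~⇒∈∁⁅⁆ G (hub~rim i)

-- The greedy walk

-- Bounds a degree from below by a list of distinct neighbours. The induction removes the head of
-- the list from `p`.
unique-⊆⇒length≤ : ∀ {p : Subset n} {xs} → Unique xs → All (_∈ p) xs → length xs ≤ ∣ p ∣
unique-⊆⇒length≤ []               []           = z≤n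
unique-⊆⇒length≤ (x≢xs ∷ xs-uniq) (x∈p ∷ xs⊆p) = ≤-trans
  (s≤s (unique-⊆⇒length≤ xs-uniq (zipWith (λ (x≢y , y∈p) → x∈p∧x≢y⇒x∈p-y y∈p (≢-sym x≢y)) (x≢xs , xs⊆p))))
  (x∈p⇒∣p-x∣<∣p∣ x∈p)

-- If every value were hit, a choice of preimages would inject `Fin n` into `Fin m`.
∃-uncovered : (f : Fin m → Fin n) → m < n → ∃ λ v → ∀ i → f i ≢ v
∃-uncovered {m} {n} f m<n with ¬∀⟶∃¬ n (λ v → ∃ λ i → f i ≡ v) (λ v → any? λ i → f i ≟ᶠ v) not-covering
  where
  not-covering : ¬ (∀ v → ∃ λ i → f i ≡ v)
  not-covering cover = <⇒≱ m<n (injective⇒≤ {f = proj₁ ∘ cover} λ {v} {w} eq →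
    trans (sym (proj₂ (cover v))) (trans (cong f eq) (proj₂ (cover w))))
... | v , uncovered = v , λ i fi≡v → uncovered (i , fi≡v)

-- A missed value would extend `f` to an injection of `Fin (suc n)` into `Fin n`.
injective⇒hits : {f : Fin n → Fin n} → Injective _≡_ _≡_ f → ∀ v → ∃ λ i → f i ≡ v
injective⇒hits {n} {f} f-inj v with any? (λ i → f i ≟ᶠ v)
... | yes hit = hit
... | no miss = contradiction (injective⇒≤ {f = g} g-inj) 1+n≰n
  where
  g : Fin (suc n) → Fin n
  g zero    = v
  g (suc i) = f i
  g-inj : Injective _≡_ _≡_ g
  g-inj {zero}  {zero}  _  = refl
  g-inj {zero}  {suc j} eq = contradiction (j , sym eq) miss
  g-inj {suc i} {zero}  eq = contradiction (i , eq) miss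
  g-inj {suc i} {suc j} eq = cong suc (f-inj eq)

injective⇒↔ : {f : Fin n → Fin n} → Injective _≡_ _≡_ f → Fin n ↔ Fin n
injective⇒↔ f-inj = ⤖⇒↔ (mk⤖ (f-inj , strictlySurjective⇒surjective (injective⇒hits f-inj)))

crossing-edge : ∀ {A : Set} {R : A → A → Set} {P : A → Set} → Decidable P →
                ∀ {u v} → Star R u v → P u → ¬ P v → ∃ λ a → ∃ λ b → R a b × P a × ¬ P b
crossing-edge P? ε                   pu ¬pv = contradiction pu ¬pv
crossing-edge P? (_◅_ {j = w} r rs) pu ¬pv with P? w
... | yes pw = crossing-edge P? rs pw ¬pv
... | no ¬pw = _ , _ , r , pu , ¬pw

module _ (G : Graph (suc n)) where
  open Graph G

  -- Otherwise `h` and `v` are two distinct non-neighbours of `h`, while only one vertex lies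
  -- outside its neighbourhood.
  deg-n⇒universal : ∀ {h} → deg G h ≡ n → ∀ {v} → h ≢ v → h ~ v
  deg-n⇒universal {h} deg≡n {v} h≢v with h ~? v
  ... | yes h~v = h~v
  ... | no h≁v  = contradiction
    (≤-trans (unique-⊆⇒length≤ ((h≢v ∷ []) ∷ [] ∷ []) (non (irrefl refl) ∷ non h≁v ∷ []))
      (≤-reflexive (trans (∣∁p∣≡n∸∣p∣ (neighbours h)) (trans (cong (suc n ∸_) deg≡n) (m+n∸n≡m 1 n)))))
    1+n≰n
    where
    non : ∀ {w} → ¬ h ~ w → w ∈ ∁ (neighbours h)
    non h≁w = x∉p⇒x∈∁p (h≁w ∘ ∈⇒~ G)

-- Degrees count the edge to `h`: besides `h`, the start `e` has one neighbour and every other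
-- vertex at most two.
module GreedyWalk (1≤n : 1 ≤ n) (G : Graph (suc n)) (h e : Fin (suc n)) (h≢e : h ≢ e)
  (h-universal : ∀ {v} → h ≢ v → Graph._~_ G h v) (connected : Connected G (∁ ⁅ h ⁆))
  (deg-e : deg G e ≡ 2) (deg≤3 : ∀ v → h ≢ v → deg G v ≤ 3) where
  open Graph G

  Next : (a b w : Fin (suc n)) → Set
  Next a b w = b ~ w × w ≢ h × w ≢ a

  next? : ∀ a b → Dec (∃ (Next a b))
  next? a b = any? λ w → (b ~? w) ×-dec ¬? (w ≟ᶠ h) ×-dec ¬? (w ≟ᶠ a)

  next : (a b : Fin (suc n)) → Fin (suc n)
  next a b with next? a b
  ... | yes (w , _) = w
  -- A dummy value, never reached when a continuation exists.
  ... | no _        = b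

  next-Next : ∀ {a b} → ∃ (Next a b) → Next a b (next a b)
  next-Next {a} {b} ∃w with next? a b
  ... | yes (_ , nw) = nw
  ... | no ∄w        = contradiction ∃w ∄w

  -- Putting `h` at position 0 matches the numbering of `fan n` and gives `e` a predecessor, so that
  -- one rule produces all further vertices.
  q : ℕ → Fin (suc n)
  q zero          = h
  q (suc zero)    = e
  q (suc (suc k)) = next (q k) (q (suc k))

  -- `saturated` concerns the vertices strictly between `h` and the current end: none of them has an
  -- edge leaving the walk.
  record Walk (k : ℕ) : Set where
    field
      distinct  : ∀ {i j} → i < j → j ≤ k → q i ≢ q j
      step      : ∀ {i} → i < k → q i ~ q (suc i)
      saturated : ∀ {i w} → suc i < k → q (suc i) ~ w → w ≡ h ⊎ w ≡ q i ⊎ w ≡ q (2 + i)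

  walk-1 : Walk 1
  walk-1 = record
    { distinct  = λ { {_} {zero} () _ ; {zero} {suc zero} _ _ → h≢e ; {suc _} {suc zero} (s≤s ()) _ ; {_} {suc (suc _)} _ (s≤s ()) }
    ; step      = λ { (s≤s z≤n) → h-universal h≢e }
    ; saturated = λ { (s≤s ()) }
    }

  module Extend {k} (walk : Walk (suc k)) (1+k<n : suc k < n) where
    open Walk walk

    Visited : Fin (suc n) → Set
    Visited v = ∃ λ i → i < 2 + k × v ≡ q i

    visited? : Decidable Visited
    visited? v = anyUpTo? (λ i → v ≟ᶠ q i) (2 + k)

    -- Some vertex `v` is unvisited, and a walk from `e` to `v` that avoids `h` must leave the
    -- visited set. It cannot do so at a saturated vertex, hence it does so at the last one.
    exit : ∃ λ b → q (suc k) ~ b × ¬ Visited b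
    exit with ∃-uncovered {2 + k} (q ∘ toℕ) (s≤s 1+k<n)
    ... | v , uncovered
      with crossing-edge visited? (connected e v (in-∁ h≢e) (in-∁ (uncovered zero)))
             (1 , s≤s (s≤s z≤n) , refl)
             (λ (i , i<2+k , v≡qi) → uncovered (fromℕ< i<2+k) (trans (cong q (toℕ-fromℕ< i<2+k)) (sym v≡qi)))
      where
      in-∁ : ∀ {v} → h ≢ v → v ∈ ∁ ⁅ h ⁆
      in-∁ h≢v = x∉p⇒x∈∁p (h≢v ∘ sym ∘ x∈⁅y⁆⇒x≡y h)
    ... | _ , b , (a∈ , _ , _)   , (zero  , _             , refl) , _  = contradiction (x∈⁅x⁆ h) (x∈∁p⇒x∉p a∈)
    ... | _ , b , (_  , _ , a~b) , (suc i , s≤s (s≤s i≤k) , refl) , ¬visited with m≤n⇒m<n∨m≡n i≤k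
    ...   | inj₂ refl = b , a~b , ¬visited
    ...   | inj₁ i<k with saturated (s≤s i<k) a~b
    ...     | inj₁ b≡h          = contradiction (0 , z<s , b≡h) ¬visited
    ...     | inj₂ (inj₁ b≡qi)  = contradiction (i , ≤-trans i<k (m≤n+m k 2) , b≡qi) ¬visited
    ...     | inj₂ (inj₂ b≡q2+) = contradiction (2 + i , s≤s (s≤s i<k) , b≡q2+) ¬visited

    -- By `exit` a continuation exists. The vertex that `next` picks could still differ from the one
    -- given by `exit`; `neighbours-last` settles this.
    next-spec : Next (q k) (q (suc k)) (q (2 + k))
    next-spec with exit
    ... | b , q~b , ¬visited = next-Next (b , q~b , (λ b≡h → ¬visited (0 , z<s , b≡h)) ,
                                          (λ b≡qk → ¬visited (k , m≤n+m (suc k) 1 , b≡qk)))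

    neighbours-last : ∀ {w} → q (suc k) ~ w → w ≡ h ⊎ w ≡ q k ⊎ w ≡ q (2 + k)
    neighbours-last {w} q~w with w ≟ᶠ h | w ≟ᶠ q k | w ≟ᶠ q (2 + k)
    ... | yes w≡h | _        | _         = inj₁ w≡h
    ... | no _    | yes w≡qk | _         = inj₂ (inj₁ w≡qk)
    ... | no _    | no _     | yes w≡q2+ = inj₂ (inj₂ w≡q2+)
    ... | no w≢h  | no w≢qk  | no w≢q2+  = ⊥-elim (too-many k refl)
      where
      q~next = proj₁ next-spec
      next≢h = proj₁ (proj₂ next-spec)
      next≢q = proj₂ (proj₂ next-spec)
      h≢last : h ≢ q (suc k)
      h≢last = distinct {0} z<s ≤-refl
      q~h : q (suc k) ~ h
      q~h = ~-sym (h-universal h≢last)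
      -- For `k = 0` the predecessor is `h` itself, and three neighbours contradict degree 2. For
      -- larger `k` the predecessor is a fourth neighbour, against degree at most 3.
      too-many : ∀ l → l ≡ k → Empty
      too-many zero    refl = 1+n≰n (≤-trans
        (unique-⊆⇒length≤ ((≢-sym w≢h ∷ ≢-sym next≢h ∷ []) ∷ (w≢q2+ ∷ []) ∷ [] ∷ [])
          (~⇒∈ G q~h ∷ ~⇒∈ G q~w ∷ ~⇒∈ G q~next ∷ []))
        (≤-reflexive deg-e))
      too-many (suc l) refl = 1+n≰n (≤-trans
        (unique-⊆⇒length≤
          ((≢-sym w≢h ∷ ≢-sym next≢h ∷ distinct {0} z<s (n≤1+n _) ∷ []) ∷ (w≢q2+ ∷ w≢qk ∷ []) ∷ (next≢q ∷ []) ∷ [] ∷ [])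
          (~⇒∈ G q~h ∷ ~⇒∈ G q~w ∷ ~⇒∈ G q~next ∷ ~⇒∈ G (~-sym (step ≤-refl)) ∷ []))
        (deg≤3 (q (suc k)) h≢last))

    -- The unvisited neighbour from `exit` is neither `h` nor `q k`, so `neighbours-last` identifies
    -- it with `q (2 + k)`.
    ¬visited-next : ¬ Visited (q (2 + k))
    ¬visited-next with exit
    ... | b , q~b , ¬visited with neighbours-last q~b
    ...   | inj₁ b≡h          = contradiction (0 , z<s , b≡h) ¬visited
    ...   | inj₂ (inj₁ b≡qk)  = contradiction (k , m≤n+m (suc k) 1 , b≡qk) ¬visited
    ...   | inj₂ (inj₂ b≡q2+) = subst (¬_ ∘ Visited) b≡q2+ ¬visited

    extend : Walk (2 + k)
    extend = record { distinct = distinct′ ; step = step′ ; saturated = saturated′ }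
      where
      distinct′ : ∀ {i j} → i < j → j ≤ 2 + k → q i ≢ q j
      distinct′ {i} i<j j≤2+k with m≤n⇒m<n∨m≡n j≤2+k
      ... | inj₁ j<2+k = distinct i<j (s≤s⁻¹ j<2+k)
      ... | inj₂ refl  = λ qi≡q2+ → ¬visited-next (i , i<j , sym qi≡q2+)
      step′ : ∀ {i} → i < 2 + k → q i ~ q (suc i)
      step′ (s≤s i≤1+k) with m≤n⇒m<n∨m≡n i≤1+k
      ... | inj₁ i<1+k = step i<1+k
      ... | inj₂ refl  = proj₁ next-spec
      saturated′ : ∀ {i w} → suc i < 2 + k → q (suc i) ~ w → w ≡ h ⊎ w ≡ q i ⊎ w ≡ q (2 + i)
      saturated′ (s≤s (s≤s i≤k)) with m≤n⇒m<n∨m≡n i≤k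
      ... | inj₁ i<k  = saturated (s≤s i<k)
      ... | inj₂ refl = neighbours-last

  walk : ∀ k → 1 ≤ k → k ≤ n → Walk k
  walk (suc zero)    _ _     = walk-1
  walk (suc (suc k)) _ 1+k<n = Extend.extend (walk (suc k) (s≤s z≤n) (<⇒≤ 1+k<n)) 1+k<n

  open Walk (walk n 1≤n ≤-refl)

  q-injective : ∀ {i j} → i ≤ n → j ≤ n → q i ≡ q j → i ≡ j
  q-injective {i} {j} i≤n j≤n eq with <-cmp i j
  ... | tri< i<j _ _ = contradiction eq (distinct i<j j≤n)
  ... | tri≈ _ i≡j _ = i≡j
  ... | tri> _ _ j<i = contradiction (sym eq) (distinct j<i i≤n)

  -- `q (suc i)` is saturated, and two of its three possible neighbours lie at positions before
  -- `suc j`; only its successor remains.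
  consecutive : ∀ {i j} → i < j → j < n → q (suc i) ~ q (suc j) → suc i ≡ j
  consecutive i<j j<n q~q with saturated (≤-trans (s≤s i<j) j<n) q~q
  ... | inj₁ q≡h          = contradiction (sym q≡h) (distinct {0} z<s j<n)
  ... | inj₂ (inj₁ q≡qi)  = contradiction (sym q≡qi) (distinct (≤-trans i<j (n≤1+n _)) j<n)
  ... | inj₂ (inj₂ q≡q2+) = sym (cong pred (q-injective j<n (≤-trans (s≤s i<j) j<n) q≡q2+))

  fan≅G : fan n ≅ G
  fan≅G = record
    { bijection = injective⇒↔ {f = q ∘ toℕ} λ {i} {j} eq →
        toℕ-injective (q-injective (s≤s⁻¹ (toℕ<n i)) (s≤s⁻¹ (toℕ<n j)) eq)
    ; adjacency = λ {u} {v} → adj u v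
    }
    where
    adj : ∀ u v → Graph._~_ (fan n) u v ⇔ (q (toℕ u) ~ q (toℕ v))
    adj zero    zero    = mk⇔ (λ 0≢0 → contradiction refl 0≢0) (λ h~h → contradiction h~h (irrefl refl))
    adj zero    (suc j) = mk⇔ (λ _ → h-universal (distinct {0} z<s (toℕ<n j))) (λ _ → tt)
    adj (suc i) zero    = mk⇔ (λ _ → ~-sym (h-universal (distinct {0} z<s (toℕ<n i)))) (λ _ → tt)
    adj (suc i) (suc j) = mk⇔ ⇒ ⇐
      where
      ⇒ : suc (toℕ i) ≡ toℕ j ⊎ suc (toℕ j) ≡ toℕ i → q (suc (toℕ i)) ~ q (suc (toℕ j))
      ⇒ (inj₁ 1+i≡j) = subst (λ k → q (suc (toℕ i)) ~ q (suc k)) 1+i≡j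
                         (step (≤-trans (s≤s (≤-reflexive 1+i≡j)) (toℕ<n j)))
      ⇒ (inj₂ 1+j≡i) = ~-sym (subst (λ k → q (suc (toℕ j)) ~ q (suc k)) 1+j≡i
                         (step (≤-trans (s≤s (≤-reflexive 1+j≡i)) (toℕ<n i))))
      ⇐ : q (suc (toℕ i)) ~ q (suc (toℕ j)) → suc (toℕ i) ≡ toℕ j ⊎ suc (toℕ j) ≡ toℕ i
      ⇐ q~q with <-cmp (toℕ i) (toℕ j)
      ... | tri< i<j _ _ = inj₁ (consecutive i<j (toℕ<n j) q~q)
      ... | tri≈ _ i≡j _ = contradiction q~q (irrefl (cong (q ∘ suc) i≡j))
      ... | tri> _ _ j<i = inj₂ (consecutive j<i (toℕ<n i) (~-sym q~q))

-- Recovering the fan from the coefficients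

term≤sum : ∀ (t : Fin n → ℕ) i → t i ≤ sum t
term≤sum t zero    = m≤m+n (t zero) _
term≤sum t (suc i) = ≤-trans (term≤sum (t ∘ suc) i) (m≤n+m _ (t zero))

two-terms≤sum : ∀ (t : Fin n → ℕ) {i j} → i ≢ j → t i + t j ≤ sum t
two-terms≤sum {suc n} t {i} {j} i≢j = begin
  t i + t j                              ≡⟨ cong (λ k → t i + t k) (punchIn-punchOut i≢j) ⟨
  t i + t (punchIn i (punchOut i≢j))     ≤⟨ +-monoʳ-≤ (t i) (term≤sum (t ∘ punchIn i) (punchOut i≢j)) ⟩
  t i + sum (t ∘ punchIn i)              ≡⟨ sum-remove {i = i} t ⟨
  sum t                                  ∎
  where open ≤-Reasoning

0<sum⇒∃ : ∀ (t : Fin n → ℕ) → 0 < sum t → ∃ λ i → 0 < t i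
0<sum⇒∃ {suc n} t 0<∑ with t zero in eq
... | suc k = zero , ≤-trans (s≤s z≤n) (≤-reflexive (sym eq))
... | zero  with 0<sum⇒∃ (t ∘ suc) 0<∑
...   | i , 0<ti = suc i , 0<ti

sum≤n : ∀ (t : Fin n → ℕ) → (∀ i → t i ≤ 1) → sum t ≤ n
sum≤n {zero}  t t≤1 = z≤n
sum≤n {suc n} t t≤1 = +-mono-≤ (t≤1 zero) (sum≤n (t ∘ suc) (t≤1 ∘ suc))

-- A failing index would leave one term fewer, each at most 1.
sum-𝟙≡n⇒all : ∀ {P : Fin n → Set} (P? : ∀ i → Dec (P i)) → sum (𝟙 ∘ P?) ≡ n → ∀ i → P i
sum-𝟙≡n⇒all {suc n} P? ∑≡1+n i with P? i in eq
... | yes p = p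
... | no _  = contradiction (begin
    suc n                                 ≡⟨ ∑≡1+n ⟨
    sum (𝟙 ∘ P?)                          ≡⟨ sum-remove {i = i} (𝟙 ∘ P?) ⟩
    𝟙 (P? i) + sum (𝟙 ∘ P? ∘ punchIn i)   ≡⟨ cong (λ d → 𝟙 d + sum (𝟙 ∘ P? ∘ punchIn i)) eq ⟩
    sum (𝟙 ∘ P? ∘ punchIn i)              ≤⟨ sum≤n (𝟙 ∘ P? ∘ punchIn i) (𝟙≤1 ∘ P? ∘ punchIn i) ⟩
    n                                     ∎) 1+n≰n
  where open ≤-Reasoning

-- The constants stand before `n` so that the exponents compute; the theorem has them in the other
-- order.
Coefficient₁ Coefficientₙ Coefficientₙ₊₁ : ℕ → ℕ[x,y] → Set
Coefficient₁ n p   = [x^ 1 ] p ≈ 2 ·y^ (n ∸ 1) ⊕ (n ∸ 2) ·y^ (n ∸ 2) ⊕ 1 ·y^ 1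
Coefficientₙ n p   = [x^ n ] p ≈ 3 ·y^ (1 + n) ⊕ (n ∸ 2) ·y^ (2 + n)
Coefficientₙ₊₁ n p = [x^ 1 + n ] p ≈ 1 ·y^ (3 + n)

coeff-term : ∀ a d k → Y.coeff k (a ·y^ d) ≡ a * Y.coeff k (1 ·y^ d)
coeff-term a d k = trans (coeff-·y^ a d k) (cong (a *_) (sym (trans (coeff-·y^ 1 d k) (+-identityʳ _))))

fan⇒coefficients : 4 ≤ n → (G : Graph (suc n)) → fan n ≅ G →
                   Coefficient₁ n (da G) × Coefficientₙ n (da G) × Coefficientₙ₊₁ n (da G)
fan⇒coefficients {n} 4≤n G iso =
    (λ k → trans (φ-singletons (coeff-additive k)) (sym (rhs₁ k)))
  , (λ k → trans (φ-cosingletons (coeff-additive k)) (sym (rhsₙ k)))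
  , (λ k → φ-all (coeff-additive k))
  where
  open FanCoefficients 4≤n G iso
  rhs₁ : ∀ k → Y.coeff k (2 ·y^ (n ∸ 1) ⊕ (n ∸ 2) ·y^ (n ∸ 2) ⊕ 1 ·y^ 1) ≡
         Y.coeff k (1 ·y^ 1) + (2 * Y.coeff k (1 ·y^ (n ∸ 1)) + (n ∸ 2) * Y.coeff k (1 ·y^ (n ∸ 2)))
  rhs₁ k = trans (coeff-⊕ k (2 ·y^ (n ∸ 1) ⊕ (n ∸ 2) ·y^ (n ∸ 2)) (1 ·y^ 1))
    (trans (+-comm _ (Y.coeff k (1 ·y^ 1))) (cong (Y.coeff k (1 ·y^ 1) +_)
      (trans (coeff-⊕ k (2 ·y^ (n ∸ 1)) ((n ∸ 2) ·y^ (n ∸ 2)))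
        (cong₂ _+_ (coeff-term 2 (n ∸ 1) k) (coeff-term (n ∸ 2) (n ∸ 2) k)))))
  rhsₙ : ∀ k → Y.coeff k (3 ·y^ (1 + n) ⊕ (n ∸ 2) ·y^ (2 + n)) ≡
         Y.coeff k (1 ·y^ (1 + n)) + (2 * Y.coeff k (1 ·y^ (1 + n)) + (n ∸ 2) * Y.coeff k (1 ·y^ (2 + n)))
  rhsₙ k = trans (coeff-⊕ k (3 ·y^ (1 + n)) ((n ∸ 2) ·y^ (2 + n)))
    (trans (cong₂ _+_ (coeff-term 3 (1 + n) k) (coeff-term (n ∸ 2) (2 + n) k))
      (+-assoc (Y.coeff k (1 ·y^ (1 + n))) _ _))

-- At y = 1 every singleton counts once, so the coefficient of x becomes the number of vertices.
order : 2 ≤ n → (G : Graph N) → Coefficient₁ n (da G) → N ≡ suc n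
order {n} {N} 2≤n G c₁ = begin
  N                                                  ≡⟨ trans (sum-const N 1) (*-identityʳ N) ⟨
  sum {N} (λ _ → 1)                                  ≡⟨ sum-cong-≗ (λ u → sumᴸ-·y^ 1 (N ∸ deg G u)) ⟨
  sum (λ u → sumᴸ (1 ·y^ (N ∸ deg G u)))             ≡⟨ φ-da-1 G sumᴸ-additive ⟨
  sumᴸ ([x^ 1 ] da G)                                ≡⟨ sumᴸ-≈ {[x^ 1 ] da G} {p ⊕ q ⊕ r} c₁ ⟩
  sumᴸ (p ⊕ q ⊕ r)                                   ≡⟨ trans (sumᴸ-⊕ (p ⊕ q) r) (cong (_+ sumᴸ r) (sumᴸ-⊕ p q)) ⟩
  sumᴸ p + sumᴸ q + sumᴸ r                           ≡⟨ cong₂ _+_ (cong₂ _+_ (sumᴸ-·y^ 2 (n ∸ 1)) (sumᴸ-·y^ (n ∸ 2) (n ∸ 2))) (sumᴸ-·y^ 1 1) ⟩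
  2 + (n ∸ 2) + 1                                    ≡⟨ cong (_+ 1) (m+[n∸m]≡n 2≤n) ⟩
  n + 1                                              ≡⟨ +-comm n 1 ⟩
  suc n                                              ∎
  where
  open ≡-Reasoning
  p = 2 ·y^ (n ∸ 1)
  q = (n ∸ 2) ·y^ (n ∸ 2)
  r = 1 ·y^ 1

-- At y = 1 each of the n + 1 deletions counts 0 or 1, and the total 3 + (n - 2) forces all of them
-- to count.
∁-connected : 2 ≤ n → (G : Graph (suc n)) → Coefficientₙ n (da G) → ∀ v → Connected G (∁ ⁅ v ⁆)
∁-connected {n} 2≤n G cₙ v = proj₂ (sum-𝟙≡n⇒all admissible total v)
  where
  admissible : ∀ v → _
  admissible v = admissible? G sumᴸ-additive (∁ ⁅ v ⁆)
  sumᴸ-weight : ∀ v → weight G sumᴸ-additive (∁ ⁅ v ⁆) ≡ 𝟙 (admissible v)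
  sumᴸ-weight v = trans (cong (𝟙 (admissible v) *_) (sumᴸ-·y^ 1 (f-y G (∁ ⁅ v ⁆)))) (*-identityʳ (𝟙 (admissible v)))
  p = 3 ·y^ (1 + n)
  q = (n ∸ 2) ·y^ (2 + n)
  open ≡-Reasoning
  total : sum (𝟙 ∘ admissible) ≡ suc n
  total = begin
    sum (𝟙 ∘ admissible)                             ≡⟨ sum-cong-≗ sumᴸ-weight ⟨
    sum (λ v → weight G sumᴸ-additive (∁ ⁅ v ⁆))     ≡⟨ φ-da-[n-1] G sumᴸ-additive ⟨
    sumᴸ ([x^ n ] da G)                              ≡⟨ sumᴸ-≈ {[x^ n ] da G} {p ⊕ q} cₙ ⟩
    sumᴸ (p ⊕ q)                                     ≡⟨ sumᴸ-⊕ p q ⟩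
    sumᴸ p + sumᴸ q                                  ≡⟨ cong₂ _+_ (sumᴸ-·y^ 3 (1 + n)) (sumᴸ-·y^ (n ∸ 2) (2 + n)) ⟩
    3 + (n ∸ 2)                                      ≡⟨ cong suc (m+[n∸m]≡n 2≤n) ⟩
    suc n                                            ∎

module Degrees (4≤n : 4 ≤ n) (G : Graph (suc n)) (c₁ : Coefficient₁ n (da G)) where

  -- The exponent of y in the term of `⁅ u ⁆`.
  codegree : Fin (suc n) → ℕ
  codegree u = suc n ∸ deg G u

  codegree⇒deg : ∀ u {d} → d ≤ suc n → codegree u ≡ suc n ∸ d → deg G u ≡ d
  codegree⇒deg u d≤1+n = ∸-cancelˡ-≡ (∣p∣≤n (Graph.neighbours G u)) d≤1+n

  -- For `4 ≤ n` the exponents 1, n - 2 and n - 1 are distinct, which keeps the count of codegree 1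
  -- apart from the other two.
  1<n-2 : 1 < n ∸ 2
  1<n-2 = ∸-monoˡ-≤ 2 4≤n

  n-2<n-1 : n ∸ 2 < n ∸ 1
  n-2<n-1 = ∸-monoʳ-< (n<1+n 1) (≤-trans (m≤m+n 2 2) 4≤n)

  codegree-count : ∀ k → sum (λ u → 𝟙 (codegree u ≟ k)) ≡ 2 * 𝟙 (n ∸ 1 ≟ k) + (n ∸ 2) * 𝟙 (n ∸ 2 ≟ k) + 1 * 𝟙 (1 ≟ k)
  codegree-count k = begin
    sum (λ u → 𝟙 (codegree u ≟ k))                   ≡⟨ sum-cong-≗ (λ u → trans (coeff-·y^ 1 (codegree u) k) (+-identityʳ _)) ⟨
    sum (λ u → Y.coeff k (1 ·y^ codegree u))         ≡⟨ φ-da-1 G (coeff-additive k) ⟨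
    Y.coeff k ([x^ 1 ] da G)                         ≡⟨ c₁ k ⟩
    Y.coeff k (p ⊕ q ⊕ 1 ·y^ 1)                      ≡⟨ trans (coeff-⊕ k (p ⊕ q) (1 ·y^ 1)) (cong (_+ Y.coeff k (1 ·y^ 1)) (coeff-⊕ k p q)) ⟩
    Y.coeff k p + Y.coeff k q + Y.coeff k (1 ·y^ 1)  ≡⟨ cong₂ _+_ (cong₂ _+_ (coeff-·y^ 2 (n ∸ 1) k) (coeff-·y^ (n ∸ 2) (n ∸ 2) k)) (coeff-·y^ 1 1 k) ⟩
    2 * 𝟙 (n ∸ 1 ≟ k) + (n ∸ 2) * 𝟙 (n ∸ 2 ≟ k) + 1 * 𝟙 (1 ≟ k) ∎
    where
    open ≡-Reasoning
    p = 2 ·y^ (n ∸ 1)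
    q = (n ∸ 2) ·y^ (n ∸ 2)

  count-1 : sum (λ u → 𝟙 (codegree u ≟ 1)) ≡ 1
  count-1 = trans (codegree-count 1) (cong₂ (λ a b → 2 * a + b + 1)
    (𝟙-false (n ∸ 1 ≟ 1) λ eq → <-irrefl (sym eq) (<-trans 1<n-2 n-2<n-1))
    (trans (cong ((n ∸ 2) *_) (𝟙-false (n ∸ 2 ≟ 1) λ eq → <-irrefl (sym eq) 1<n-2)) (*-zeroʳ (n ∸ 2))))

  count-0 : ∀ {k} → n ∸ 1 ≢ k → n ∸ 2 ≢ k → 1 ≢ k → sum (λ u → 𝟙 (codegree u ≟ k)) ≡ 0
  count-0 {k} n-1≢k n-2≢k 1≢k = trans (codegree-count k) (cong₂ _+_ (cong₂ (λ a b → 2 * a + b)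
    (𝟙-false (n ∸ 1 ≟ k) n-1≢k)
    (trans (cong ((n ∸ 2) *_) (𝟙-false (n ∸ 2 ≟ k) n-2≢k)) (*-zeroʳ (n ∸ 2))))
    (cong (1 *_) (𝟙-false (1 ≟ k) 1≢k)))

  ∃-codegree : ∀ k → 0 < sum (λ u → 𝟙 (codegree u ≟ k)) → ∃ λ u → codegree u ≡ k
  ∃-codegree k 0<count with 0<sum⇒∃ _ 0<count
  ... | u , 0<𝟙 = u , 𝟙>0 (codegree u ≟ k) 0<𝟙

  hub : ∃ λ h → codegree h ≡ 1
  hub = ∃-codegree 1 (≤-reflexive (sym count-1))

  h = proj₁ hub

  deg-h : deg G h ≡ n
  deg-h = codegree⇒deg h (n≤1+n n) (trans (proj₂ hub) (sym (m+n∸n≡m 1 n)))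

  end : ∃ λ e → codegree e ≡ n ∸ 1
  end = ∃-codegree (n ∸ 1) (≤-trans (≤-trans (≤-trans (m≤m+n 1 1) (≤-reflexive (cong (2 *_) (sym (𝟙-true (n ∸ 1 ≟ n ∸ 1) refl)))))
    (≤-trans (m≤m+n _ _) (m≤m+n _ _))) (≤-reflexive (sym (codegree-count (n ∸ 1)))))

  e = proj₁ end

  deg-e : deg G e ≡ 2
  -- `n ∸ 1` is `suc n ∸ 2` by computation, hence degree 2.
  deg-e = codegree⇒deg e (s≤s (≤-trans (m≤m+n 1 3) 4≤n)) (proj₂ end)

  h≢e : h ≢ e
  h≢e h≡e = <-irrefl (trans (sym deg-e) (trans (cong (deg G) (sym h≡e)) deg-h)) (≤-trans (m≤m+n 3 1) 4≤n)

  codegree-values : ∀ k → 0 < sum (λ u → 𝟙 (codegree u ≟ k)) → k ≡ n ∸ 1 ⊎ k ≡ n ∸ 2 ⊎ k ≡ 1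
  codegree-values k 0<count with n ∸ 1 ≟ k | n ∸ 2 ≟ k | 1 ≟ k
  ... | yes eq  | _       | _      = inj₁ (sym eq)
  ... | no _    | yes eq  | _      = inj₂ (inj₁ (sym eq))
  ... | no _    | no _    | yes eq = inj₂ (inj₂ (sym eq))
  ... | no n-1≢ | no n-2≢ | no 1≢  = contradiction (sym (count-0 n-1≢ n-2≢ 1≢)) (<⇒≢ 0<count)

  codegree-1-unique : ∀ {u v} → codegree u ≡ 1 → codegree v ≡ 1 → u ≡ v
  codegree-1-unique {u} {v} u≡1 v≡1 = decidable-stable (u ≟ᶠ v) λ u≢v → 1+n≰n (≤-trans
    (≤-reflexive (sym (cong₂ _+_ (𝟙-true (codegree u ≟ 1) u≡1) (𝟙-true (codegree v ≟ 1) v≡1))))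
    (≤-trans (two-terms≤sum (λ u → 𝟙 (codegree u ≟ 1)) u≢v) (≤-reflexive count-1)))

  -- The codegree of `v` is one of the three exponents; the value 1 belongs to `h` alone, and the
  -- other two mean degree 2 or 3.
  deg≤3 : ∀ v → h ≢ v → deg G v ≤ 3
  deg≤3 v h≢v = bound (codegree-values (codegree v) (≤-trans
    (≤-reflexive (sym (𝟙-true (codegree v ≟ codegree v) refl))) (term≤sum (λ u → 𝟙 (codegree u ≟ codegree v)) v)))
    where
    bound : codegree v ≡ n ∸ 1 ⊎ codegree v ≡ n ∸ 2 ⊎ codegree v ≡ 1 → deg G v ≤ 3
    bound (inj₁ eq)        = ≤-trans (≤-reflexive (codegree⇒deg v (s≤s (≤-trans (m≤m+n 1 3) 4≤n)) eq)) (n≤1+n 2)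
    bound (inj₂ (inj₁ eq)) = ≤-reflexive (codegree⇒deg v (s≤s (≤-trans (m≤m+n 2 2) 4≤n)) eq)
    bound (inj₂ (inj₂ eq)) = contradiction (codegree-1-unique (proj₂ hub) eq) h≢v

coefficients⇒fan : 4 ≤ n → (G : Graph (suc n)) → Coefficient₁ n (da G) → Coefficientₙ n (da G) → fan n ≅ G
coefficients⇒fan 4≤n G c₁ cₙ = GreedyWalk.fan≅G (≤-trans (m≤m+n 1 3) 4≤n) G h e h≢e
  (deg-n⇒universal G deg-h) (∁-connected (≤-trans (m≤m+n 2 2) 4≤n) G cₙ h) deg-e deg≤3
  where open Degrees 4≤n G c₁

fan-characterisation : 4 ≤ n → (G : Graph N) →
  fan n ≅ G ⇔ (Coefficient₁ n (da G) × Coefficientₙ n (da G) × Coefficientₙ₊₁ n (da G))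
fan-characterisation {n} {N} 4≤n G = mk⇔ ⇒ ⇐
  where
  ⇒ : fan n ≅ G → _
  ⇒ iso with refl ← ↔⇒≡ (_≅_.bijection iso) = fan⇒coefficients 4≤n G iso
  ⇐ : _ → fan n ≅ G
  -- The first coefficient fixes the number of vertices, so that `G` can be treated as a graph on
  -- `suc n` vertices.
  ⇐ (c₁ , cₙ , _) with refl ← order (≤-trans (m≤m+n 2 2) 4≤n) G c₁ = coefficients⇒fan 4≤n G c₁ cₙ

proposition34 : (n : ℕ) → n ≥ 4 → (N : ℕ) → .{{_ : NonZero N}} → (G : Graph N) →
    (G ≅ openWheel n) ⇔
    ( ([x^ 1 ] da G ≈ 2 ·y^ (n ∸ 1) ⊕ (n ∸ 2) ·y^ (n ∸ 2) ⊕ 1 ·y^ 1)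
    × ([x^ n ] da G ≈ 3 ·y^ (n + 1) ⊕ (n ∸ 2) ·y^ (n + 2))
    × ([x^ (n + 1) ] da G ≈ 1 ·y^ (n + 3)))
proposition34 n n≥4 N G = reindex ⇔-∘ (fan-characterisation n≥4 G ⇔-∘ mk⇔
    (λ iso → ≅-trans (join-comm (complete 1) (path n)) (≅-sym iso))
    (λ iso → ≅-trans (≅-sym iso) (join-comm (complete 1) (path n))))
  where
  reindex : (Coefficient₁ n (da G) × Coefficientₙ n (da G) × Coefficientₙ₊₁ n (da G)) ⇔
    ( ([x^ 1 ] da G ≈ 2 ·y^ (n ∸ 1) ⊕ (n ∸ 2) ·y^ (n ∸ 2) ⊕ 1 ·y^ 1)
    × ([x^ n ] da G ≈ 3 ·y^ (n + 1) ⊕ (n ∸ 2) ·y^ (n + 2))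
    × ([x^ (n + 1) ] da G ≈ 1 ·y^ (n + 3)))
  reindex rewrite +-comm n 1 | +-comm n 2 | +-comm n 3 = ⇔-id _
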